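{- There is an algorithm which, given the coefficients of a monic univariate polynomial $p\in\mathbb{R}[x]$ of degree $d\ge 1$, decides whether $p(x)\ge 0$ for all $x\in\mathbb{R}$ using at most $O(d^2)$ elementary operations on real numbers, where the implied constant is absolute.
   Context: The computational model is exact arithmetic on real numbers: each addition, subtraction, multiplication, division, and comparison/sign test of real numbers counts as one elementary operation. -}

module Defs where

open import Algebra.Bundles using (CommutativeRing; Semiring)
import Algebra.Definitions.RawMonoid as RawMonoidDefs
import Algebra.Definitions.RawSemiring as RawSemiringDefs
open import Data.Bool.Base using (Bool)
open import Data.Fin.Base using (Fin; toℕ)
open import Data.Nat.Base using (ℕ; suc)
open import Data.Product.Base using (_×_; ∃; ∃-syntax)
open import Data.Vec.Base using (Vec; _∷_; lookup; last)
open import Level using (0ℓ)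
open import Relation.Binary.Core using (Rel)
import Relation.Binary.Construct.StrictToNonStrict as StrictToNonStrict
open import Relation.Binary.Structures using (IsStrictTotalOrder)
open import Relation.Nullary.Negation.Core using (¬_)

-- The classical axioms of ℝ, which determine it up to isomorphism.  The
-- trichotomy contained in isStrictTotalOrder is what makes the exact sign tests
-- of the computational model meaningful.
record CompleteOrderedField : Set₁ where
  field
    commutativeRing : CommutativeRing 0ℓ 0ℓ

  open CommutativeRing commutativeRing public

  infix 4 _<_
  field
    _<_                : Rel Carrier 0ℓ
    isStrictTotalOrder : IsStrictTotalOrder _≈_ _<_
    0<1                : 0# < 1#
    +-monoˡ-<          : ∀ z {x y} → x < y → x + z < y + z
    *-positive         : ∀ {x y} → 0# < x → 0# < y → 0# < x * y
    invertible         : ∀ {x} → ¬ (x ≈ 0#) → ∃[ y ] x * y ≈ 1#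

  open StrictToNonStrict _≈_ _<_ public using (_≤_)

  UpperBound : (Carrier → Set) → Carrier → Set
  UpperBound P u = ∀ {x} → P x → x ≤ u

  field
    supremum : (P : Carrier → Set) → ∃ P → ∃ (UpperBound P) →
               ∃[ s ] UpperBound P s × (∀ {u} → UpperBound P u → s ≤ u)

  open RawMonoidDefs +-rawMonoid public using (sum)
  open RawSemiringDefs (Semiring.rawSemiring semiring) public
    using (_^_)

-- An algebraic computation tree whose n registers hold real numbers.  A
-- computed value is prepended to the registers, so that it becomes register 0.
-- The only real constants are 0 and 1.

data Operand (n : ℕ) : Set where
  reg  : Fin n → Operand n
  zero : Operand n
  one  : Operand n

data ArithOp : Set where
  add sub mul div : ArithOp

data Tree (n : ℕ) : Set where
  answer  : Bool → Tree n
  compute : ArithOp → Operand n → Operand n → Tree (suc n) → Tree n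
  compare : Operand n → Operand n →
            (less equal greater : Tree n) → Tree n

-- A procedure that turns d into a computation on the d + 1 coefficients of a
-- polynomial of degree d, without reference to any model of the real numbers.
Algorithm : Set
Algorithm = (d : ℕ) → Tree (suc d)

module Semantics (R : CompleteOrderedField) where

  open CompleteOrderedField R

  value : ∀ {n} → Vec Carrier n → Operand n → Carrier
  value ρ (reg i) = lookup ρ i
  value ρ zero    = 0#
  value ρ one     = 1#

  Computes : ArithOp → Carrier → Carrier → Carrier → Set
  Computes add x y z = z ≈ x + y
  Computes sub x y z = z ≈ x - y
  Computes mul x y z = z ≈ x * y
  Computes div x y z = ¬ (y ≈ 0#) × z * y ≈ x

  -- ρ ⊢ t ⇓ b after k: on registers ρ, the tree t halts with answer b, having
  -- executed exactly k arithmetic operations and comparisons.  A division by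
  -- zero has no derivation.
  infix 4 _⊢_⇓_after_
  data _⊢_⇓_after_ {n} (ρ : Vec Carrier n) : Tree n → Bool → ℕ → Set where
    answer  : ∀ {b} → ρ ⊢ answer b ⇓ b after 0
    compute : ∀ {op u v t b k} (z : Carrier) →
              Computes op (value ρ u) (value ρ v) z →
              (z ∷ ρ) ⊢ t ⇓ b after k →
              ρ ⊢ compute op u v t ⇓ b after suc k
    less    : ∀ {u v l e g b k} → value ρ u < value ρ v →
              ρ ⊢ l ⇓ b after k →
              ρ ⊢ compare u v l e g ⇓ b after suc k
    equal   : ∀ {u v l e g b k} → value ρ u ≈ value ρ v →
              ρ ⊢ e ⇓ b after k →
              ρ ⊢ compare u v l e g ⇓ b after suc k
    greater : ∀ {u v l e g b k} → value ρ v < value ρ u →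
              ρ ⊢ g ⇓ b after k →
              ρ ⊢ compare u v l e g ⇓ b after suc k

  -- A polynomial a₀ + a₁x + ⋯ + a_d x^d is the vector (a₀, a₁, …, a_d).

  eval : ∀ {n} → Vec Carrier n → Carrier → Carrier
  eval a x = sum (λ i → lookup a i * x ^ toℕ i)

  Monic : ∀ {d} → Vec Carrier (suc d) → Set
  Monic a = last a ≈ 1#

  Nonnegative : ∀ {n} → Vec Carrier n → Set
  Nonnegative a = ∀ x → 0# ≤ eval a x

{-# OPTIONS --safe #-}
module Submission where

-- A monic p of even degree is nonnegative iff no real root of f = p′ has p < 0
-- there.  For polynomials D and N the Cauchy index of N / D is the number of
-- poles at which N / D jumps from - to + minus the number at which it jumps from
-- + to -.  It does not change when a multiple of D is added to N, and the indices
-- of N / D and D / N add up to a quantity determined by degrees and leading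
-- coefficients, so Euclid's algorithm computes it in quadratic time.  The
-- sign of f′ p / f jumps at a root a of f by twice the sign of p a, and that of
-- f′ p² / f by twice the sign of (p a)², so the sum of the indices of - f′ p / f
-- and f′ p² / f vanishes iff no root of f has p < 0.

open import Defs
import Algebra.Properties.Ring
import Algebra.Properties.Semiring.Exp
import Algebra.Properties.Semiring.Mult.TCOptimised
import Algebra.Properties.Semiring.Sum
import Algebra.Solver.Ring
open import Algebra.Bundles using (CommutativeRing)
open import Algebra.Definitions.RawMagma using (_,_)
open import Algebra.Solver.Ring.AlmostCommutativeRing
  using (AlmostCommutativeRing; fromCommutativeRing; _-Raw-AlmostCommutative⟶_)
open import Data.Bool.Base using (Bool; true; false)
open import Data.Empty using (⊥)
open import Data.Fin.Base using (zero; suc; toℕ)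
open import Data.Integer.Base as ℤ using (ℤ; +_; -[1+_])
import Data.Integer.Properties as ℤ
import Data.Integer.Solver
open import Data.List.Base using (List; []; _∷_; length; map; _∷ʳ_)
import Data.List.Properties as List
open import Data.List.Relation.Binary.Pointwise as Pointwise
  using (Pointwise; []; _∷_; Pointwise-length)
open import Data.Maybe.Base using (Maybe; just; nothing)
open import Data.Nat.Base as ℕ using (ℕ; zero; suc; z≤n; s≤s)
import Data.Nat.Properties as ℕ
import Data.Nat.Solver
open import Data.Product.Base using (_×_; _,_; ∃-syntax; Σ-syntax; proj₁; proj₂)
open import Data.Product.Properties using (≡-dec)
import Data.Sign.Base as Sign
open import Data.Sum.Base using (_⊎_; inj₁; inj₂)
open import Data.Vec.Base using (Vec; []; _∷_; lookup; last)
open import Function.Base using (_∘_; case_of_; id)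
open import Level using (0ℓ)
open import Relation.Binary.Bundles using (StrictPartialOrder)
import Relation.Binary.Construct.StrictToNonStrict as StrictToNonStrict
open import Relation.Binary.Definitions using (Tri; tri<; tri≈; tri>)
open import Relation.Binary.PropositionalEquality as ≡ using (_≡_)
import Relation.Binary.Reasoning.Setoid
import Relation.Binary.Reasoning.StrictPartialOrder
open import Relation.Binary.Structures using (IsStrictTotalOrder)
open import Relation.Nullary using (¬_; Dec; yes; no; does; contradiction)
open import Relation.Nullary.Decidable using (decidable-stable)
open import Relation.Nullary.Negation using (negated-stable)
open import Relation.Nullary.Reflects using (Reflects; ofʸ; ofⁿ)

-- The obstacle is that a Cauchy index is a sum over real poles, and these are never listed or
-- isolated. So `Index D N j` asks for an integer-valued step function with the right jumps at
-- hypothetical points. Each Euclidean step keeps such a function or subtracts it from the sign of D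
-- N, and only its values far to the left and far to the right enter j. To compare those two ends
-- without counting jumps, completeness is used once, as induction along the real line: a property
-- of the step function that survives every point survives from one end to the other. Two queries
-- are added because sgn (p²) - sgn p is 2 where p < 0 and 0 elsewhere. The contributions of
-- different roots therefore cannot cancel: either there is no jump at all, or every jump is upwards
-- and one is strict. The factor f′ turns a root of f of any multiplicity into a simple pole of f′ /
-- f with positive residue, so multiple roots are treated like simple ones, without a gcd.

module IntegerCoefficients (R : CommutativeRing 0ℓ 0ℓ) where

  open CommutativeRing R
  open Algebra.Properties.Ring ring
  open Algebra.Properties.Semiring.Mult.TCOptimised semiring
    using (×-homo-+; ×1-homo-*) renaming (_×_ to _×′_)
  open Relation.Binary.Reasoning.Setoid setoid

  private

    -- The solver must recognise equal coefficients by computation, and the order test of an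
    -- abstract field does not reduce. Its coefficients are therefore integers, sent along the
    -- canonical ring homomorphism. The chosen multiple makes `1 ×′ 1#` reduce to `1#`, so that
    -- `con (+ 1)` denotes literally `1#`.
    ⟦_⟧ : ℤ → Carrier
    ⟦ + n ⟧      = n ×′ 1#
    ⟦ -[1+ n ] ⟧ = - (suc n ×′ 1#)

    suc-× : ∀ n → suc n ×′ 1# ≈ 1# + n ×′ 1#
    suc-× n = ×-homo-+ 1# 1 n

    ⟦⟧-⊖ : ∀ m n → ⟦ m ℤ.⊖ n ⟧ ≈ m ×′ 1# - n ×′ 1#
    ⟦⟧-⊖ m       zero    = sym (trans (+-congˡ -0#≈0#) (+-identityʳ _))
    ⟦⟧-⊖ zero    (suc n) = sym (+-identityˡ _)
    ⟦⟧-⊖ (suc m) (suc n) = begin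
      ⟦ suc m ℤ.⊖ suc n ⟧                      ≡⟨ ≡.cong ⟦_⟧ (ℤ.[1+m]⊖[1+n]≡m⊖n m n) ⟩
      ⟦ m ℤ.⊖ n ⟧                              ≈⟨ ⟦⟧-⊖ m n ⟩
      m ×′ 1# - n ×′ 1#                        ≈⟨ +-congʳ (+-identityˡ _) ⟨
      0# + m ×′ 1# - n ×′ 1#                   ≈⟨ +-congʳ (+-congʳ (-‿inverseʳ 1#)) ⟨
      1# - 1# + m ×′ 1# - n ×′ 1#              ≈⟨ +-congʳ (+-assoc _ _ _) ⟩
      1# + (- 1# + m ×′ 1#) - n ×′ 1#          ≈⟨ +-congʳ (+-congˡ (+-comm _ _)) ⟩
      1# + (m ×′ 1# - 1#) - n ×′ 1#            ≈⟨ +-congʳ (+-assoc _ _ _) ⟨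
      1# + m ×′ 1# - 1# - n ×′ 1#              ≈⟨ +-assoc _ _ _ ⟩
      1# + m ×′ 1# + (- 1# - n ×′ 1#)          ≈⟨ +-congˡ (-‿+-comm _ _) ⟩
      1# + m ×′ 1# - (1# + n ×′ 1#)            ≈⟨ +-cong (suc-× m) (-‿cong (suc-× n)) ⟨
      suc m ×′ 1# - suc n ×′ 1#                ∎

    ⟦⟧-+ : ∀ i j → ⟦ i ℤ.+ j ⟧ ≈ ⟦ i ⟧ + ⟦ j ⟧
    ⟦⟧-+ (+ m)      (+ n)      = ×-homo-+ 1# m n
    ⟦⟧-+ (+ m)      (-[1+ n ]) = ⟦⟧-⊖ m (suc n)
    ⟦⟧-+ (-[1+ m ]) (+ n)      = trans (⟦⟧-⊖ n (suc m)) (+-comm _ _)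
    ⟦⟧-+ (-[1+ m ]) (-[1+ n ]) = begin
      - (suc (suc (m ℕ.+ n)) ×′ 1#)     ≈⟨ -‿cong (suc-× (suc (m ℕ.+ n))) ⟩
      - (1# + (suc m ℕ.+ n) ×′ 1#)      ≈⟨ -‿cong (+-congˡ (×-homo-+ 1# (suc m) n)) ⟩
      - (1# + (suc m ×′ 1# + n ×′ 1#))  ≈⟨ -‿cong (+-congˡ (+-comm _ _)) ⟩
      - (1# + (n ×′ 1# + suc m ×′ 1#))  ≈⟨ -‿cong (+-assoc _ _ _) ⟨
      - (1# + n ×′ 1# + suc m ×′ 1#)    ≈⟨ -‿cong (+-congʳ (suc-× n)) ⟨
      - (suc n ×′ 1# + suc m ×′ 1#)     ≈⟨ -‿cong (+-comm _ _) ⟩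
      - (suc m ×′ 1# + suc n ×′ 1#)     ≈⟨ -‿+-comm _ _ ⟨
      - (suc m ×′ 1#) - suc n ×′ 1#     ∎

    ⟦⟧-neg : ∀ i → ⟦ ℤ.- i ⟧ ≈ - ⟦ i ⟧
    ⟦⟧-neg (+ zero)   = sym -0#≈0#
    ⟦⟧-neg (+ suc n)  = refl
    ⟦⟧-neg -[1+ n ]   = sym (-‿involutive _)

    ⟦-◃⟧ : ∀ n → ⟦ Sign.- ℤ.◃ n ⟧ ≈ - (n ×′ 1#)
    ⟦-◃⟧ zero    = sym -0#≈0#
    ⟦-◃⟧ (suc n) = refl

    ⟦+◃⟧ : ∀ n → ⟦ Sign.+ ℤ.◃ n ⟧ ≈ n ×′ 1#
    ⟦+◃⟧ zero    = refl
    ⟦+◃⟧ (suc n) = refl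

    ⟦⟧-* : ∀ i j → ⟦ i ℤ.* j ⟧ ≈ ⟦ i ⟧ * ⟦ j ⟧
    ⟦⟧-* (+ m)    (+ n)    = trans (⟦+◃⟧ (m ℕ.* n)) (×1-homo-* m n)
    ⟦⟧-* (+ m)    -[1+ n ] = begin
      ⟦ Sign.- ℤ.◃ (m ℕ.* suc n) ⟧    ≈⟨ ⟦-◃⟧ (m ℕ.* suc n) ⟩
      - ((m ℕ.* suc n) ×′ 1#)         ≈⟨ -‿cong (×1-homo-* m (suc n)) ⟩
      - (m ×′ 1# * suc n ×′ 1#)       ≈⟨ -‿distribʳ-* _ _ ⟩
      m ×′ 1# * - (suc n ×′ 1#)       ∎
    ⟦⟧-* -[1+ m ] (+ n)    = begin
      ⟦ Sign.- ℤ.◃ (suc m ℕ.* n) ⟧    ≈⟨ ⟦-◃⟧ (suc m ℕ.* n) ⟩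
      - ((suc m ℕ.* n) ×′ 1#)         ≈⟨ -‿cong (×1-homo-* (suc m) n) ⟩
      - (suc m ×′ 1# * n ×′ 1#)       ≈⟨ -‿distribˡ-* _ _ ⟩
      - (suc m ×′ 1#) * n ×′ 1#       ∎
    ⟦⟧-* -[1+ m ] -[1+ n ] = begin
      (suc m ℕ.* suc n) ×′ 1#              ≈⟨ ×1-homo-* (suc m) (suc n) ⟩
      suc m ×′ 1# * suc n ×′ 1#            ≈⟨ -‿involutive _ ⟨
      - - (suc m ×′ 1# * suc n ×′ 1#)      ≈⟨ -‿cong (-‿distribʳ-* _ _) ⟩
      - (suc m ×′ 1# * - (suc n ×′ 1#))    ≈⟨ -‿distribˡ-* _ _ ⟩
      - (suc m ×′ 1#) * - (suc n ×′ 1#)    ∎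

    almostCommutativeRing : AlmostCommutativeRing 0ℓ 0ℓ
    almostCommutativeRing = fromCommutativeRing R

    morphism : CommutativeRing.rawRing ℤ.+-*-commutativeRing
               -Raw-AlmostCommutative⟶ almostCommutativeRing
    morphism = record
      { ⟦_⟧    = ⟦_⟧
      ; +-homo = ⟦⟧-+
      ; *-homo = ⟦⟧-*
      ; -‿homo = ⟦⟧-neg
      ; 0-homo = refl
      ; 1-homo = refl
      }

    _coeff≟_ : ∀ i j → Maybe (⟦ i ⟧ ≈ ⟦ j ⟧)
    i coeff≟ j with i ℤ.≟ j
    ... | yes ≡.refl = just refl
    ... | no  _      = nothing

  open Algebra.Solver.Ring _ almostCommutativeRing morphism _coeff≟_ public
    using (solve; _:=_; con; _:+_; _:*_; _:-_; :-_)

-- Ordered-field arithmetic and the sign function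

module OrderedFieldProperties (R : CompleteOrderedField) where

  open CompleteOrderedField R
  open IntegerCoefficients commutativeRing public

  open IsStrictTotalOrder isStrictTotalOrder public
    using (<-resp-≈; <-respʳ-≈; <-respˡ-≈; isStrictPartialOrder)
    renaming (compare to <-cmp; trans to <-trans; irrefl to <-irrefl; asym to <-asym)

  strictPartialOrder : StrictPartialOrder 0ℓ 0ℓ 0ℓ
  strictPartialOrder = record { isStrictPartialOrder = isStrictPartialOrder }

  module ≤-Reasoning = Relation.Binary.Reasoning.StrictPartialOrder strictPartialOrder
  open ≤-Reasoning

  -- Opaque, because with-abstraction would normalise the proofs found by solve.
  opaque

    <⇒≤ : ∀ {x y} → x < y → x ≤ y
    <⇒≤ = inj₁

    ≤-reflexive : ∀ {x y} → x ≈ y → x ≤ y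
    ≤-reflexive = inj₂

    ≤-trans : ∀ {x y z} → x ≤ y → y ≤ z → x ≤ z
    ≤-trans = StrictToNonStrict.trans _≈_ _<_ isEquivalence <-resp-≈ <-trans

    <-≤-trans : ∀ {x y z} → x < y → y ≤ z → x < z
    <-≤-trans = StrictToNonStrict.<-≤-trans _≈_ _<_ <-trans <-respʳ-≈

    ≤-<-trans : ∀ {x y z} → x ≤ y → y < z → x < z
    ≤-<-trans = StrictToNonStrict.≤-<-trans _≈_ _<_ sym <-trans <-respˡ-≈

    ≤⇒≯ : ∀ {x y} → x ≤ y → ¬ (y < x)
    ≤⇒≯ x≤y y<x = <-irrefl refl (≤-<-trans x≤y y<x)

    ≮⇒≥ : ∀ {x y} → ¬ (x < y) → y ≤ x
    ≮⇒≥ {x} {y} x≮y with <-cmp x y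
    ... | tri< x<y _ _ = contradiction x<y x≮y
    ... | tri≈ _ x≈y _ = inj₂ (sym x≈y)
    ... | tri> _ _ y<x = inj₁ y<x

    <⇒≉ : ∀ {x y} → x < y → ¬ (x ≈ y)
    <⇒≉ x<y x≈y = <-irrefl x≈y x<y

    >⇒≉ : ∀ {x y} → y < x → ¬ (x ≈ y)
    >⇒≉ y<x x≈y = <-irrefl (sym x≈y) y<x

    <⇒0<- : ∀ {x y} → x < y → 0# < y - x
    <⇒0<- {x} {y} x<y = begin-strict
      0#     ≈⟨ -‿inverseʳ x ⟨
      x - x  <⟨ +-monoˡ-< (- x) x<y ⟩
      y - x  ∎

    0<-⇒< : ∀ {x y} → 0# < y - x → x < y
    0<-⇒< {x} {y} 0<y-x = begin-strict
      x          ≈⟨ +-identityˡ x ⟨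
      0# + x     <⟨ +-monoˡ-< x 0<y-x ⟩
      y - x + x  ≈⟨ solve 2 (λ x y → y :- x :+ x := y) refl x y ⟩
      y          ∎

    +-monoˡ-≤ : ∀ z {x y} → x ≤ y → x + z ≤ y + z
    +-monoˡ-≤ z (inj₁ x<y) = inj₁ (+-monoˡ-< z x<y)
    +-monoˡ-≤ z (inj₂ x≈y) = inj₂ (+-congʳ x≈y)

    +-mono-≤ : ∀ {u v x y} → u ≤ v → x ≤ y → u + x ≤ v + y
    +-mono-≤ {u} {v} {x} {y} u≤v x≤y = begin
      u + x  ≤⟨ +-monoˡ-≤ x u≤v ⟩
      v + x  ≈⟨ +-comm v x ⟩
      x + v  ≤⟨ +-monoˡ-≤ v x≤y ⟩
      y + v  ≈⟨ +-comm y v ⟩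
      v + y  ∎

    +-positive : ∀ {x y} → 0# < x → 0# ≤ y → 0# < x + y
    +-positive {x} {y} 0<x 0≤y = begin-strict
      0#      ≤⟨ 0≤y ⟩
      y       ≈⟨ +-identityˡ y ⟨
      0# + y  <⟨ +-monoˡ-< y 0<x ⟩
      x + y   ∎

    +-nonNegative : ∀ {x y} → 0# ≤ x → 0# ≤ y → 0# ≤ x + y
    +-nonNegative {x} {y} 0≤x 0≤y = begin
      0#       ≈⟨ +-identityʳ 0# ⟨
      0# + 0#  ≤⟨ +-mono-≤ 0≤x 0≤y ⟩
      x + y    ∎

    *-nonNegative : ∀ {x y} → 0# ≤ x → 0# ≤ y → 0# ≤ x * y
    *-nonNegative (inj₁ 0<x) (inj₁ 0<y) = inj₁ (*-positive 0<x 0<y)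
    *-nonNegative {x} {y} (inj₂ 0≈x) _  = inj₂ (sym (trans (*-congʳ (sym 0≈x)) (zeroˡ y)))
    *-nonNegative {x} {y} _ (inj₂ 0≈y)  = inj₂ (sym (trans (*-congˡ (sym 0≈y)) (zeroʳ x)))

    ≤⇒0≤- : ∀ {x y} → x ≤ y → 0# ≤ y - x
    ≤⇒0≤- {x} (inj₁ x<y) = inj₁ (<⇒0<- x<y)
    ≤⇒0≤- {x} (inj₂ x≈y) = inj₂ (sym (trans (+-congʳ (sym x≈y)) (-‿inverseʳ x)))

    0≤-⇒≤ : ∀ {x y} → 0# ≤ y - x → x ≤ y
    0≤-⇒≤ {x} {y} 0≤y-x = begin
      x          ≈⟨ +-identityˡ x ⟨
      0# + x     ≤⟨ +-monoˡ-≤ x 0≤y-x ⟩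
      y - x + x  ≈⟨ solve 2 (λ x y → y :- x :+ x := y) refl x y ⟩
      y          ∎

    neg-positive : ∀ {x} → x < 0# → 0# < - x
    neg-positive {x} x<0 = <-respʳ-≈ (+-identityˡ (- x)) (<⇒0<- x<0)

    neg-negative : ∀ {x} → 0# < x → - x < 0#
    neg-negative {x} 0<x = 0<-⇒< (<-respʳ-≈ (solve 1 (λ x → x := con (+ 0) :- :- x) refl x) 0<x)

    *-positive-negative : ∀ {x y} → 0# < x → y < 0# → x * y < 0#
    *-positive-negative {x} {y} 0<x y<0 = 0<-⇒< (<-respʳ-≈
      (solve 2 (λ x y → x :* :- y := con (+ 0) :- x :* y) refl x y)
      (*-positive 0<x (neg-positive y<0)))

    *-negative-positive : ∀ {x y} → x < 0# → 0# < y → x * y < 0#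
    *-negative-positive {x} {y} x<0 0<y = <-respˡ-≈ (*-comm y x) (*-positive-negative 0<y x<0)

    *-negative : ∀ {x y} → x < 0# → y < 0# → 0# < x * y
    *-negative {x} {y} x<0 y<0 = <-respʳ-≈
      (solve 2 (λ x y → :- x :* :- y := x :* y) refl x y)
      (*-positive (neg-positive x<0) (neg-positive y<0))

    square-nonNegative : ∀ x → 0# ≤ x * x
    square-nonNegative x with <-cmp x 0#
    ... | tri< x<0 _ _ = inj₁ (*-negative x<0 x<0)
    ... | tri≈ _ x≈0 _ = inj₂ (sym (trans (*-congʳ x≈0) (zeroˡ x)))
    ... | tri> _ _ 0<x = inj₁ (*-positive 0<x 0<x)

    *-monoˡ-≤ : ∀ {x y z} → 0# ≤ z → x ≤ y → x * z ≤ y * z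
    *-monoˡ-≤ {x} {y} {z} 0≤z x≤y = 0≤-⇒≤ (≤-trans (*-nonNegative (≤⇒0≤- x≤y) 0≤z)
      (≤-reflexive (solve 3 (λ x y z → (y :- x) :* z := y :* z :- x :* z) refl x y z)))

    *-mono-≤ : ∀ {u v x y} → 0# ≤ v → 0# ≤ x → u ≤ v → x ≤ y → u * x ≤ v * y
    *-mono-≤ {u} {v} {x} {y} 0≤v 0≤x u≤v x≤y = begin
      u * x  ≤⟨ *-monoˡ-≤ 0≤x u≤v ⟩
      v * x  ≈⟨ *-comm v x ⟩
      x * v  ≤⟨ *-monoˡ-≤ 0≤v x≤y ⟩
      y * v  ≈⟨ *-comm y v ⟩
      v * y  ∎

    ≉0-* : ∀ {x y} → ¬ (x ≈ 0#) → ¬ (y ≈ 0#) → ¬ (x * y ≈ 0#)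
    ≉0-* {x} {y} x≉0 y≉0 xy≈0 with y⁻¹ , y*y⁻¹≈1 ← invertible y≉0 = x≉0 (begin-equality
      x              ≈⟨ *-identityʳ x ⟨
      x * 1#         ≈⟨ *-congˡ y*y⁻¹≈1 ⟨
      x * (y * y⁻¹)  ≈⟨ *-assoc x y y⁻¹ ⟨
      x * y * y⁻¹    ≈⟨ *-congʳ xy≈0 ⟩
      0# * y⁻¹       ≈⟨ zeroˡ y⁻¹ ⟩
      0#             ∎)

    *-cancelˡ-≉0 : ∀ {x y z} → ¬ (x ≈ 0#) → x * y ≈ x * z → y ≈ z
    *-cancelˡ-≉0 {x} {y} {z} x≉0 xy≈xz with x⁻¹ , x*x⁻¹≈1 ← invertible x≉0 = begin-equality
      y              ≈⟨ *-identityˡ y ⟨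
      1# * y         ≈⟨ *-congʳ x*x⁻¹≈1 ⟨
      x * x⁻¹ * y    ≈⟨ solve 3 (λ x w y → x :* w :* y := w :* (x :* y)) refl x x⁻¹ y ⟩
      x⁻¹ * (x * y)  ≈⟨ *-congˡ xy≈xz ⟩
      x⁻¹ * (x * z)  ≈⟨ solve 3 (λ x w y → x :* w :* y := w :* (x :* y)) refl x x⁻¹ z ⟨
      x * x⁻¹ * z    ≈⟨ *-congʳ x*x⁻¹≈1 ⟩
      1# * z         ≈⟨ *-identityˡ z ⟩
      z              ∎

    positive-factor : ∀ {x y} → 0# < x → 0# < x * y → 0# < y
    positive-factor {x} {y} 0<x 0<xy with <-cmp y 0#
    ... | tri< y<0 _ _ = contradiction (*-positive-negative 0<x y<0) (<-asym 0<xy)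
    ... | tri≈ _ y≈0 _ = contradiction (sym (trans (*-congˡ y≈0) (zeroʳ x))) (<⇒≉ 0<xy)
    ... | tri> _ _ 0<y = 0<y

    -- The midpoint: `h` is the inverse of 2, so the gaps on both sides equal `(y - x) * h`.
    dense : ∀ {x y} → x < y → ∃[ z ] x < z × z < y
    dense {x} {y} x<y = m , 0<-⇒< (<-respʳ-≈ m-x (*-positive 0<y-x 0<h))
                          , 0<-⇒< (<-respʳ-≈ y-m (*-positive 0<y-x 0<h))
      where
      0<2 : 0# < 1# + 1#
      0<2 = +-positive 0<1 (<⇒≤ 0<1)
      h : Carrier
      h = proj₁ (invertible (>⇒≉ 0<2))
      2h≈1 : (1# + 1#) * h ≈ 1#
      2h≈1 = proj₂ (invertible (>⇒≉ 0<2))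
      0<h : 0# < h
      0<h = positive-factor 0<2 (<-respʳ-≈ (sym 2h≈1) 0<1)
      0<y-x : 0# < y - x
      0<y-x = <⇒0<- x<y
      m : Carrier
      m = x + (y - x) * h
      m-x : (y - x) * h ≈ m - x
      m-x = solve 3 (λ x y h → (y :- x) :* h := x :+ (y :- x) :* h :- x) refl x y h
      y-m : (y - x) * h ≈ y - m
      y-m = begin-equality
        (y - x) * h                                 ≈⟨ solve 3 (λ x y h → (y :- x) :* h :=
                                                         (y :- x) :* (con (+ 2) :* h) :- (y :- x) :* h) refl x y h ⟩
        (y - x) * ((1# + 1#) * h) - (y - x) * h     ≈⟨ +-congʳ (*-congˡ 2h≈1) ⟩
        (y - x) * 1# - (y - x) * h                  ≈⟨ solve 3 (λ x y h → (y :- x) :* con (+ 1) :- (y :- x) :* h :=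
                                                         y :- (x :+ (y :- x) :* h)) refl x y h ⟩
        y - m                                       ∎

    x<x+1 : ∀ x → x < x + 1#
    x<x+1 x = 0<-⇒< (<-respʳ-≈ (solve 1 (λ x → con (+ 1) := x :+ con (+ 1) :- x) refl x) 0<1)

    x-1<x : ∀ x → x - 1# < x
    x-1<x x = 0<-⇒< (<-respʳ-≈ (solve 1 (λ x → con (+ 1) := x :- (x :- con (+ 1))) refl x) 0<1)

    meet : ∀ {x y z} → x < y → x < z → ∃[ w ] x < w × w ≤ y × w ≤ z
    meet {x} {y} {z} x<y x<z with <-cmp y z
    ... | tri< y<z _ _ = y , x<y , inj₂ refl , inj₁ y<z
    ... | tri≈ _ y≈z _ = y , x<y , inj₂ refl , inj₂ y≈z
    ... | tri> _ _ z<y = z , x<z , inj₁ z<y , inj₂ refl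

    join : ∀ {x y z} → x < z → y < z → ∃[ w ] w < z × x ≤ w × y ≤ w
    join {x} {y} {z} x<z y<z with <-cmp x y
    ... | tri< x<y _ _ = y , y<z , inj₁ x<y , inj₂ refl
    ... | tri≈ _ x≈y _ = y , y<z , inj₂ x≈y , inj₂ refl
    ... | tri> _ _ y<x = x , x<z , inj₂ refl , inj₁ y<x

    above : ∀ x y → ∃[ z ] x ≤ z × y ≤ z
    above x y with <-cmp x y
    ... | tri< x<y _ _ = y , inj₁ x<y , inj₂ refl
    ... | tri≈ _ x≈y _ = y , inj₂ x≈y , inj₂ refl
    ... | tri> _ _ y<x = x , inj₂ refl , inj₁ y<x

    under : ∀ x y → ∃[ z ] z ≤ x × z ≤ y
    under x y with <-cmp x y
    ... | tri< x<y _ _ = x , inj₂ refl , inj₁ x<y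
    ... | tri≈ _ x≈y _ = x , inj₂ refl , inj₂ x≈y
    ... | tri> _ _ y<x = y , inj₁ y<x , inj₂ refl

    sgn : Carrier → ℤ
    sgn x with <-cmp x 0#
    ... | tri< _ _ _ = ℤ.-1ℤ
    ... | tri≈ _ _ _ = ℤ.0ℤ
    ... | tri> _ _ _ = ℤ.1ℤ

    sgn-negative : ∀ {x} → x < 0# → sgn x ≡ ℤ.-1ℤ
    sgn-negative {x} x<0 with <-cmp x 0#
    ... | tri< _ _ _   = ≡.refl
    ... | tri≈ x≮0 _ _ = contradiction x<0 x≮0
    ... | tri> x≮0 _ _ = contradiction x<0 x≮0

    sgn-zero : ∀ {x} → x ≈ 0# → sgn x ≡ ℤ.0ℤ
    sgn-zero {x} x≈0 with <-cmp x 0#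
    ... | tri< _ x≉0 _ = contradiction x≈0 x≉0
    ... | tri≈ _ _ _   = ≡.refl
    ... | tri> _ x≉0 _ = contradiction x≈0 x≉0

    sgn-positive : ∀ {x} → 0# < x → sgn x ≡ ℤ.1ℤ
    sgn-positive {x} 0<x with <-cmp x 0#
    ... | tri< _ _ x≯0 = contradiction 0<x x≯0
    ... | tri≈ _ _ x≯0 = contradiction 0<x x≯0
    ... | tri> _ _ _   = ≡.refl

    sgn-cong : ∀ {x y} → x ≈ y → sgn x ≡ sgn y
    sgn-cong {x} {y} x≈y with <-cmp x 0#
    ... | tri< x<0 _ _ = ≡.sym (sgn-negative (<-respˡ-≈ x≈y x<0))
    ... | tri≈ _ x≈0 _ = ≡.sym (sgn-zero (trans (sym x≈y) x≈0))
    ... | tri> _ _ 0<x = ≡.sym (sgn-positive (<-respʳ-≈ x≈y 0<x))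

    sgn-* : ∀ x y → sgn (x * y) ≡ sgn x ℤ.* sgn y
    sgn-* x y with <-cmp x 0# | <-cmp y 0#
    ... | tri< x<0 _ _ | tri< y<0 _ _ = sgn-positive (*-negative x<0 y<0)
    ... | tri< _ _ _   | tri≈ _ y≈0 _ = sgn-zero (trans (*-congˡ y≈0) (zeroʳ x))
    ... | tri< x<0 _ _ | tri> _ _ 0<y = sgn-negative (*-negative-positive x<0 0<y)
    ... | tri≈ _ x≈0 _ | _            = sgn-zero (trans (*-congʳ x≈0) (zeroˡ y))
    ... | tri> _ _ 0<x | tri< y<0 _ _ = sgn-negative (*-positive-negative 0<x y<0)
    ... | tri> _ _ _   | tri≈ _ y≈0 _ = sgn-zero (trans (*-congˡ y≈0) (zeroʳ x))
    ... | tri> _ _ 0<x | tri> _ _ 0<y = sgn-positive (*-positive 0<x 0<y)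

-- This is (-1)^n i. It relates the signs of a function with a factor of order n on the two sides of
-- a point, and those of a polynomial of degree n near the two infinities.
flip : ℕ → ℤ → ℤ
flip zero    i = i
flip (suc n) i = ℤ.- flip n i

flip-+ : ∀ m n i → flip (m ℕ.+ n) i ≡ flip m (flip n i)
flip-+ zero    n i = ≡.refl
flip-+ (suc m) n i = ≡.cong ℤ.-_ (flip-+ m n i)

flip-neg : ∀ n i → flip n (ℤ.- i) ≡ ℤ.- flip n i
flip-neg zero    i = ≡.refl
flip-neg (suc n) i = ≡.cong ℤ.-_ (flip-neg n i)

flip-flip : ∀ n i → flip n (flip n i) ≡ i
flip-flip zero    i = ≡.refl
flip-flip (suc n) i = ≡.trans (≡.cong ℤ.-_ (flip-neg n (flip n i)))
                      (≡.trans (ℤ.neg-involutive _) (flip-flip n i))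

flip-even : ∀ n i → flip (n ℕ.+ n) i ≡ i
flip-even n i = ≡.trans (flip-+ n n i) (flip-flip n i)

flip-* : ∀ m n i j → flip m i ℤ.* flip n j ≡ flip (m ℕ.+ n) (i ℤ.* j)
flip-* zero    zero    i j = ≡.refl
flip-* zero    (suc n) i j = ≡.trans (≡.sym (ℤ.neg-distribʳ-* i (flip n j))) (≡.cong ℤ.-_ (flip-* 0 n i j))
flip-* (suc m) n       i j = ≡.trans (≡.sym (ℤ.neg-distribˡ-* (flip m i) (flip n j))) (≡.cong ℤ.-_ (flip-* m n i j))

flip-±1 : ∀ n → flip n ℤ.1ℤ ≡ ℤ.1ℤ ⊎ flip n ℤ.1ℤ ≡ ℤ.-1ℤ
flip-±1 zero    = inj₁ ≡.refl
flip-±1 (suc n) with flip-±1 n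
... | inj₁ ≡1  = inj₂ (≡.cong ℤ.-_ ≡1)
... | inj₂ ≡-1 = inj₁ (≡.cong ℤ.-_ ≡-1)

-- One-sided germs, induction along the real line, and local continuity

module Germs (R : CompleteOrderedField) where

  open CompleteOrderedField R
  open OrderedFieldProperties R
  open Algebra.Properties.Ring ring using (-0#≈0#; -‿involutive)
  open ≤-Reasoning

  module _ {V : Set} where

    -- One-sided limits of a step function. The value at `a` itself is left free, because the step
    -- functions built later have no meaningful value at a pole.
    Left Right : (Carrier → V) → Carrier → V → Set
    Left  φ a v = ∃[ l ] l < a × (∀ {y} → l < y → y < a → φ y ≡ v)
    Right φ a v = ∃[ r ] a < r × (∀ {y} → a < y → y < r → φ y ≡ v)

    Left-unique : ∀ {φ a v w} → Left φ a v → Left φ a w → v ≡ w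
    Left-unique (l , l<a , φ≡v) (m , m<a , φ≡w)
      with k , k<a , l≤k , m≤k ← join l<a m<a
      with y , k<y , y<a ← dense k<a
      = ≡.trans (≡.sym (φ≡v (≤-<-trans l≤k k<y) y<a)) (φ≡w (≤-<-trans m≤k k<y) y<a)

    Left-cong : ∀ {φ a b v} → a ≈ b → Left φ a v → Left φ b v
    Left-cong a≈b (l , l<a , φ≡v) =
      l , <-respʳ-≈ a≈b l<a , λ l<y y<b → φ≡v l<y (<-respʳ-≈ (sym a≈b) y<b)

    Right-cong : ∀ {φ a b v} → a ≈ b → Right φ a v → Right φ b v
    Right-cong a≈b (r , a<r , φ≡v) =
      r , <-respˡ-≈ a≈b a<r , λ b<y y<r → φ≡v (<-respˡ-≈ (sym a≈b) b<y) y<r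

  module _ {U V W : Set} (f : U → V → W) where

    Left-zip : ∀ {φ ψ a v w} → Left φ a v → Left ψ a w → Left (λ x → f (φ x) (ψ x)) a (f v w)
    Left-zip (l , l<a , φ≡) (m , m<a , ψ≡) with k , k<a , l≤k , m≤k ← join l<a m<a
      = k , k<a , λ k<y y<a → ≡.cong₂ f (φ≡ (≤-<-trans l≤k k<y) y<a) (ψ≡ (≤-<-trans m≤k k<y) y<a)

    Right-zip : ∀ {φ ψ a v w} → Right φ a v → Right ψ a w → Right (λ x → f (φ x) (ψ x)) a (f v w)
    Right-zip (r , a<r , φ≡) (s , a<s , ψ≡) with k , a<k , k≤r , k≤s ← meet a<r a<s
      = k , a<k , λ a<y y<k → ≡.cong₂ f (φ≡ a<y (<-≤-trans y<k k≤r)) (ψ≡ a<y (<-≤-trans y<k k≤s))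

  module _ {V : Set} where

    -- Induction along the real line: completeness replaces a walk through the jumps, whose number
    -- and places are unknown. `stable` is there because a point below the supremum is exceeded by a
    -- member of `Reach` only up to double negation.
    module Propagation
      (φ : Carrier → V) (Q : V → Set) (stable : ∀ v → ¬ ¬ Q v → Q v)
      (germs : ∀ a → ∃[ v ] ∃[ w ] Left φ a v × Right φ a w × (Q v → Q w))
      where

      private
        Good : Carrier → Set
        Good u = ∀ {v} → Left φ u v → Q v

        Reach : Carrier → Carrier → Carrier → Set
        Reach x y t = t ≤ y × (∀ {u} → x < u → u ≤ t → Good u)

        reach-start : ∀ {x y} → x < y → Reach x y x
        reach-start x<y = <⇒≤ x<y , λ x<u u≤x → contradiction x<u (≤⇒≯ u≤x)

        module AtSupremum
          {x y v s} (x<y : x < y) (right-x : Right φ x v) (qv : Q v)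
          (upper : UpperBound (Reach x y) s)
          (least : ∀ {u} → UpperBound (Reach x y) u → s ≤ u)
          where

          below : ∀ {u} → x < u → u < s → Good u
          below {u} x<u u<s {v′} left-u = stable v′ λ ¬qv′ →
            ≤⇒≯ (least λ {t} (_ , good) →
              ≮⇒≥ λ u<t → ¬qv′ (good x<u (<⇒≤ u<t) left-u)) u<s

          -- The left germ at `s` is constant on an interval, hence it is also the left germ at
          -- points of that interval, which are good because they lie below `s`.
          left-s : x < s → Good s
          left-s x<s (l , l<s , φ≡)
            with k , k<s , l≤k , x≤k ← join l<s x<s
            with u , k<u , u<s ← dense k<s
            = below (≤-<-trans x≤k k<u) u<s
                (k , k<u , λ k<z z<u → φ≡ (≤-<-trans l≤k k<z) (<-trans z<u u<s))

          right-s : x ≤ s → ∃[ v′ ] Right φ s v′ × Q v′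
          right-s (inj₂ x≈s) = v , Right-cong x≈s right-x , qv
          right-s (inj₁ x<s) with l , r , left , right , step ← germs s
            = r , right , step (left-s x<s left)

          -- The right germ at `s` satisfies `Q` and is constant on an interval, so it gives the
          -- left germs of all points there. `Reach` would then extend past its supremum.
          s≮y : x ≤ s → ¬ (s < y)
          s≮y x≤s s<y
            with v′ , (r , s<r , φ≡v′) , qv′ ← right-s x≤s
            with m , s<m , m≤r , m≤y ← meet s<r s<y
            with t , s<t , t<m ← dense s<m
            = ≤⇒≯ (upper (<⇒≤ (<-≤-trans t<m m≤y) , good)) s<t
            where
            good : ∀ {u} → x < u → u ≤ t → Good u
            good {u} x<u u≤t left-u with <-cmp u s
            ... | tri< u<s _ _ = below x<u u<s left-u
            ... | tri≈ _ u≈s _ = left-s (<-respʳ-≈ u≈s x<u) (Left-cong u≈s left-u)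
            ... | tri> _ _ s<u = ≡.subst Q (Left-unique
              (s , s<u , λ s<z z<u → φ≡v′ s<z
                (<-trans z<u (≤-<-trans u≤t (<-≤-trans t<m m≤r)))) left-u) qv′

          good-y : x ≤ s → s ≤ y → Good y
          good-y x≤s (inj₁ s<y) = contradiction s<y (s≮y x≤s)
          good-y x≤s (inj₂ s≈y) left-y =
            left-s (<-respʳ-≈ (sym s≈y) x<y) (Left-cong (sym s≈y) left-y)

      propagate : ∀ {x y v w} → x < y → Right φ x v → Q v → Left φ y w → Q w
      propagate {x} {y} x<y right-x qv
        with s , upper , least ← supremum (Reach x y) (x , reach-start x<y) (y , proj₁)
        = AtSupremum.good-y x<y right-x qv upper least (upper (reach-start x<y)) (least proj₁)

  -- Squares stand for absolute values: F is bounded on the closed interval of radius 1 around `a`.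
  Bounded : (Carrier → Carrier) → Carrier → Set
  Bounded F a = ∃[ M ] 0# ≤ M × (∀ x → (x - a) * (x - a) ≤ 1# → F x * F x ≤ M)

  opaque

    bounded-const : ∀ {a} c → Bounded (λ _ → c) a
    bounded-const c = c * c , square-nonNegative c , λ _ _ → ≤-reflexive refl

    bounded-shift : ∀ {a} → Bounded (λ x → x - a) a
    bounded-shift = 1# , <⇒≤ 0<1 , λ _ near → near

    bounded-* : ∀ {F G a} → Bounded F a → Bounded G a → Bounded (λ x → F x * G x) a
    bounded-* {F} {G} (M , 0≤M , F≤M) (N , 0≤N , G≤N) =
      M * N , *-nonNegative 0≤M 0≤N , λ x near → begin
        F x * G x * (F x * G x)
          ≈⟨ solve 2 (λ f g → f :* g :* (f :* g) := f :* f :* (g :* g)) refl (F x) (G x) ⟩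
        F x * F x * (G x * G x)      ≤⟨ *-mono-≤ 0≤M (square-nonNegative (G x)) (F≤M x near) (G≤N x near) ⟩
        M * N                        ∎

    bounded-+ : ∀ {F G a} → Bounded F a → Bounded G a → Bounded (λ x → F x + G x) a
    bounded-+ {F} {G} {a} (M , 0≤M , F≤M) (N , 0≤N , G≤N) =
      (M + N) + (M + N) , +-nonNegative (+-nonNegative 0≤M 0≤N) (+-nonNegative 0≤M 0≤N) , λ x near → begin
        (F x + G x) * (F x + G x)                              ≈⟨ +-identityʳ _ ⟨
        -- Adding (F - G)² turns the square of the sum into 2 (F² + G²).
        (F x + G x) * (F x + G x) + 0#
          ≤⟨ +-mono-≤ (≤-reflexive refl) (square-nonNegative (F x - G x)) ⟩
        (F x + G x) * (F x + G x) + (F x - G x) * (F x - G x)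
          ≈⟨ solve 2 (λ f g → (f :+ g) :* (f :+ g) :+ (f :- g) :* (f :- g) :=
                                                                    (f :* f :+ g :* g) :+ (f :* f :+ g :* g)) refl (F x) (G x) ⟩
        (F x * F x + G x * G x) + (F x * F x + G x * G x)      ≤⟨ +-mono-≤ (F²+G²≤ x near) (F²+G²≤ x near) ⟩
        (M + N) + (M + N)                                      ∎
      where
      F²+G²≤ : ∀ x → (x - a) * (x - a) ≤ 1# → F x * F x + G x * G x ≤ M + N
      F²+G²≤ x near = +-mono-≤ (F≤M x near) (G≤N x near)

    bounded-cong : ∀ {F G a} → (∀ x → F x ≈ G x) → Bounded F a → Bounded G a
    bounded-cong F≈G (M , 0≤M , F≤M) =
      M , 0≤M , λ x near → ≤-trans (≤-reflexive (sym (*-cong (F≈G x) (F≈G x)))) (F≤M x near)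

  -- Continuity at one point in algebraic form: sums and products are handled by identities and
  -- bounds on slopes, and an ε has to be chosen only once, in `positive-near`.
  record LipschitzAt (F : Carrier → Carrier) (a : Carrier) : Set where
    constructor lipschitz
    field
      slope   : Carrier → Carrier
      expand  : ∀ x → F x ≈ F a + (x - a) * slope x
      bounded : Bounded slope a

  open LipschitzAt

  opaque

    lipschitz⇒bounded : ∀ {F a} → LipschitzAt F a → Bounded F a
    lipschitz⇒bounded {F} {a} LF = bounded-cong (λ x → sym (expand LF x))
      (bounded-+ (bounded-const (F a)) (bounded-* bounded-shift (bounded LF)))

    lipschitz-const : ∀ {a} c → LipschitzAt (λ _ → c) a
    lipschitz-const {a} c = lipschitz (λ _ → 0#)
      (λ x → solve 3 (λ c x a → c := c :+ (x :- a) :* con (+ 0)) refl c x a) (bounded-const 0#)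

    lipschitz-id : ∀ {a} → LipschitzAt (λ x → x) a
    lipschitz-id {a} = lipschitz (λ _ → 1#)
      (λ x → solve 2 (λ x a → x := a :+ (x :- a) :* con (+ 1)) refl x a) (bounded-const 1#)

    lipschitz-+ : ∀ {F G a} → LipschitzAt F a → LipschitzAt G a → LipschitzAt (λ x → F x + G x) a
    lipschitz-+ {F} {G} {a} LF LG = lipschitz (λ x → slope LF x + slope LG x)
      (λ x → trans (+-cong (expand LF x) (expand LG x))
        (solve 5 (λ f g d k l → (f :+ d :* k) :+ (g :+ d :* l) := (f :+ g) :+ d :* (k :+ l)) refl
          (F a) (G a) (x - a) (slope LF x) (slope LG x)))
      (bounded-+ (bounded LF) (bounded LG))

    lipschitz-* : ∀ {F G a} → LipschitzAt F a → LipschitzAt G a → LipschitzAt (λ x → F x * G x) a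
    lipschitz-* {F} {G} {a} LF LG = lipschitz (λ x → slope LF x * G x + F a * slope LG x)
      (λ x → begin-equality
        F x * G x                                                  ≈⟨ *-congʳ (expand LF x) ⟩
        (F a + (x - a) * slope LF x) * G x                         ≈⟨ solve 4 (λ f d k g → (f :+ d :* k) :* g :=
                                                                        f :* g :+ d :* k :* g) refl
                                                                        (F a) (x - a) (slope LF x) (G x) ⟩
        F a * G x + (x - a) * slope LF x * G x                     ≈⟨ +-congʳ (*-congˡ (expand LG x)) ⟩
        F a * (G a + (x - a) * slope LG x) + (x - a) * slope LF x * G x
                                                                   ≈⟨ solve 6 (λ f d k g h l → f :* (h :+ d :* l) :+ d :* k :* g :=
                                                                        f :* h :+ d :* (k :* g :+ f :* l)) refl
                                                                        (F a) (x - a) (slope LF x) (G x) (G a) (slope LG x) ⟩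
        F a * G a + (x - a) * (slope LF x * G x + F a * slope LG x)  ∎)
      (bounded-+ (bounded-* (bounded LF) (lipschitz⇒bounded LG))
                 (bounded-* (bounded-const (F a)) (bounded LG)))

    lipschitz-cong : ∀ {F G a} → (∀ x → F x ≈ G x) → LipschitzAt F a → LipschitzAt G a
    lipschitz-cong {a = a} F≈G LF = lipschitz (slope LF)
      (λ x → trans (sym (F≈G x)) (trans (expand LF x) (+-congʳ (F≈G a)))) (bounded LF)

    lipschitz-neg : ∀ {F a} → LipschitzAt F a → LipschitzAt (λ x → - F x) a
    lipschitz-neg {F} LF = lipschitz-cong
      (λ x → solve 1 (λ f → :- con (+ 1) :* f := :- f) refl (F x))
      (lipschitz-* (lipschitz-const (- 1#)) LF)

    lipschitz-shift : ∀ {a} b → LipschitzAt (λ x → x - b) a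
    lipschitz-shift b = lipschitz-+ lipschitz-id (lipschitz-const (- b))

    lipschitz-^ : ∀ {F a} n → LipschitzAt F a → LipschitzAt (λ x → F x ^ n) a
    lipschitz-^ zero    LF = lipschitz-const 1#
    lipschitz-^ (suc n) LF = lipschitz-* LF (lipschitz-^ n LF)

    small : ∀ {c M} → 0# < c → 0# ≤ M → ∃[ ε ] 0# < ε × ε ≤ 1# × ε * M < c
    small {c} {M} 0<c 0≤M = go (+-positive 0<1 (+-nonNegative 0≤M (<⇒≤ 0<c)))
      where
      go : 0# < 1# + (M + c) → ∃[ ε ] 0# < ε × ε ≤ 1# × ε * M < c
      -- The witness is ε = c / (1 + M + c): its denominator is at least c, so ε ≤ 1, and exceeds M,
      -- so ε M < c.
      go 0<B with B⁻¹ , BB⁻¹≈1 ← invertible (>⇒≉ 0<B) = c * B⁻¹ , 0<ε , ε≤1 , εM<c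
        where
        0<B⁻¹ : 0# < B⁻¹
        0<B⁻¹ = positive-factor 0<B (<-respʳ-≈ (sym BB⁻¹≈1) 0<1)
        0<ε : 0# < c * B⁻¹
        0<ε = *-positive 0<c 0<B⁻¹
        εB≈c : c * B⁻¹ * (1# + (M + c)) ≈ c
        εB≈c = trans (solve 3 (λ c b b′ → c :* b′ :* b := c :* (b :* b′)) refl c (1# + (M + c)) B⁻¹)
                     (trans (*-congˡ BB⁻¹≈1) (*-identityʳ c))
        ε≤1 : c * B⁻¹ ≤ 1#
        ε≤1 = begin
          c * B⁻¹               ≤⟨ *-monoˡ-≤ (<⇒≤ 0<B⁻¹) (0≤-⇒≤ (≤-trans (+-nonNegative (<⇒≤ 0<1) 0≤M)
                                     (≤-reflexive (solve 2 (λ m c → con (+ 1) :+ m :=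
                                       con (+ 1) :+ (m :+ c) :- c) refl M c)))) ⟩
          (1# + (M + c)) * B⁻¹  ≈⟨ BB⁻¹≈1 ⟩
          1#                    ∎
        εM<c : c * B⁻¹ * M < c
        εM<c = <-respʳ-≈ εB≈c (0<-⇒< (<-respʳ-≈
          (solve 3 (λ e m c → e :* (con (+ 1) :+ c) := e :* (con (+ 1) :+ (m :+ c)) :- e :* m)
            refl (c * B⁻¹) M c)
          (*-positive 0<ε (+-positive 0<1 (<⇒≤ 0<c)))))

  opaque

    -- A point x at distance less than ε from a with F x ≤ 0 < c = F a would
    -- give c ≤ - (x - a) * slope x, hence c² ≤ ε² M ≤ ε M < c².
    positive-near : ∀ {F a} → LipschitzAt F a → 0# < F a →
                    ∃[ l ] ∃[ r ] l < a × a < r × (∀ {x} → l < x → x < r → 0# < F x)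
    positive-near {F} {a} LF 0<c = go (bounded LF)
      where
      go : Bounded (slope LF) a → ∃[ l ] ∃[ r ] l < a × a < r × (∀ {x} → l < x → x < r → 0# < F x)
      go (M , 0≤M , K≤M) with ε , 0<ε , ε≤1 , εM<c² ← small (*-positive 0<c 0<c) 0≤M =
        a - ε , a + ε ,
        0<-⇒< (<-respʳ-≈ (solve 2 (λ a e → e := a :- (a :- e)) refl a ε) 0<ε) ,
        0<-⇒< (<-respʳ-≈ (solve 2 (λ a e → e := a :+ e :- a) refl a ε) 0<ε) ,
        positive
        where
        module _ {x} (l<x : a - ε < x) (x<r : x < a + ε) (Fx≤0 : F x ≤ 0#) where
          d²≤ε² : (x - a) * (x - a) ≤ ε * ε
          d²≤ε² = <⇒≤ (0<-⇒< (<-respʳ-≈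
            (solve 3 (λ x a e → (a :+ e :- x) :* (x :- (a :- e)) := e :* e :- (x :- a) :* (x :- a)) refl x a ε)
            (*-positive (<⇒0<- x<r) (<⇒0<- l<x))))
          d²≤ε : (x - a) * (x - a) ≤ ε
          d²≤ε = ≤-trans d²≤ε² (≤-trans (*-monoˡ-≤ (<⇒≤ 0<ε) ε≤1) (≤-reflexive (*-identityˡ ε)))
          c≤-dk : F a ≤ - ((x - a) * slope LF x)
          c≤-dk = 0≤-⇒≤ (≤-trans (≤⇒0≤- Fx≤0) (≤-reflexive (trans (+-congˡ (-‿cong (expand LF x)))
            (solve 2 (λ c z → con (+ 0) :- (c :+ z) := :- z :- c) refl (F a) ((x - a) * slope LF x)))))
          c²≤εM : F a * F a ≤ ε * M
          c²≤εM = begin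
            F a * F a
              ≤⟨ *-mono-≤ (≤-trans (<⇒≤ 0<c) c≤-dk) (<⇒≤ 0<c) c≤-dk c≤-dk ⟩
            - ((x - a) * slope LF x) * - ((x - a) * slope LF x)
              ≈⟨ solve 2 (λ d k → :- (d :* k) :* :- (d :* k) := d :* d :* (k :* k)) refl (x - a) (slope LF x) ⟩
            (x - a) * (x - a) * (slope LF x * slope LF x)
              ≤⟨ *-mono-≤ (<⇒≤ 0<ε) (square-nonNegative (slope LF x)) d²≤ε (K≤M x (≤-trans d²≤ε ε≤1)) ⟩
            ε * M ∎
        positive : ∀ {x} → a - ε < x → x < a + ε → 0# < F x
        positive {x} l<x x<r with <-cmp 0# (F x)
        ... | tri< 0<Fx _ _ = 0<Fx
        ... | tri≈ _ 0≈Fx _ = contradiction εM<c² (≤⇒≯ (c²≤εM l<x x<r (inj₂ (sym 0≈Fx))))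
        ... | tri> _ _ Fx<0 = contradiction εM<c² (≤⇒≯ (c²≤εM l<x x<r (inj₁ Fx<0)))

  opaque

    sgn-near : ∀ {F a} → LipschitzAt F a → ¬ (F a ≈ 0#) →
               ∃[ l ] ∃[ r ] l < a × a < r × (∀ {x} → l < x → x < r → sgn (F x) ≡ sgn (F a))
    sgn-near {F} {a} LF Fa≉0 with <-cmp (F a) 0#
    ... | tri≈ _ Fa≈0 _ = contradiction Fa≈0 Fa≉0
    ... | tri> _ _ 0<Fa with l , r , l<a , a<r , 0<F ← positive-near LF 0<Fa
      = l , r , l<a , a<r , λ l<x x<r → ≡.trans (sgn-positive (0<F l<x x<r)) (≡.sym (sgn-positive 0<Fa))
    ... | tri< Fa<0 _ _
      with l , r , l<a , a<r , 0<-F ← positive-near (lipschitz-neg LF) (neg-positive Fa<0)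
      = l , r , l<a , a<r , λ {x} l<x x<r → ≡.trans
          (sgn-negative (<-respˡ-≈ (-‿involutive (F x)) (neg-negative (0<-F l<x x<r))))
          (≡.sym (sgn-negative Fa<0))

    -- A nonzero value at `a` would keep its sign on a neighbourhood, which contains other points.
    -- This carries identities obtained by dividing by x - a over to the point `a` itself.
    vanishing : ∀ {F a} → LipschitzAt F a → (∀ x → ¬ (x ≈ a) → F x ≈ 0#) → F a ≈ 0#
    vanishing {F} {a} LF F≈0 with <-cmp (F a) 0#
    ... | tri≈ _ Fa≈0 _ = Fa≈0
    ... | tri> _ Fa≉0 0<Fa
      with l , r , l<a , a<r , 0<F ← positive-near LF 0<Fa
      with x , a<x , x<r ← dense a<r
      = contradiction (sym (F≈0 x (>⇒≉ a<x))) (<⇒≉ (0<F (<-trans l<a a<x) x<r))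
    ... | tri< Fa<0 Fa≉0 _
      with l , r , l<a , a<r , 0<-F ← positive-near (lipschitz-neg LF) (neg-positive Fa<0)
      with x , a<x , x<r ← dense a<r
      = contradiction (sym (trans (-‿cong (F≈0 x (>⇒≉ a<x))) -0#≈0#)) (<⇒≉ (0<-F (<-trans l<a a<x) x<r))

  opaque

    sgn-^-positive : ∀ {x} n y → 0# < x → sgn (x ^ n * y) ≡ sgn y
    sgn-^-positive zero y 0<x = sgn-cong (*-identityˡ y)
    sgn-^-positive {x} (suc n) y 0<x
      rewrite sgn-cong (*-assoc x (x ^ n) y) | sgn-* x (x ^ n * y)
            | sgn-positive 0<x | sgn-^-positive n y 0<x = ℤ.*-identityˡ (sgn y)

    sgn-^-negative : ∀ {x} n y → x < 0# → sgn (x ^ n * y) ≡ flip n (sgn y)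
    sgn-^-negative zero y x<0 = sgn-cong (*-identityˡ y)
    sgn-^-negative {x} (suc n) y x<0
      rewrite sgn-cong (*-assoc x (x ^ n) y) | sgn-* x (x ^ n * y)
            | sgn-negative x<0 | sgn-^-negative n y x<0 = ℤ.-1*i≡-i _

  module _ {F h : Carrier → Carrier} {a : Carrier} (n : ℕ)
           (F≈ : ∀ x → F x ≈ (x - a) ^ n * h x) (Lh : LipschitzAt h a) (h≉0 : ¬ (h a ≈ 0#)) where

    sgn-right : Right (sgn ∘ F) a (sgn (h a))
    sgn-right with l , r , l<a , a<r , sgn≡ ← sgn-near Lh h≉0
      = r , a<r , λ {y} a<y y<r →
        ≡.trans (sgn-cong (F≈ y)) (≡.trans (sgn-^-positive n (h y) (<⇒0<- a<y)) (sgn≡ (<-trans l<a a<y) y<r))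

    sgn-left : Left (sgn ∘ F) a (flip n (sgn (h a)))
    sgn-left with l , r , l<a , a<r , sgn≡ ← sgn-near Lh h≉0
      = l , l<a , λ {y} l<y y<a →
        ≡.trans (sgn-cong (F≈ y)) (≡.trans (sgn-^-negative n (h y)
          (0<-⇒< (<-respʳ-≈ (solve 2 (λ a y → a :- y := con (+ 0) :- (y :- a)) refl a y) (<⇒0<- y<a))))
          (≡.cong (flip n) (sgn≡ l<y (<-trans y<a a<r))))

-- Polynomials, derivatives and orders of vanishing

module Polynomials (R : CompleteOrderedField) where

  open CompleteOrderedField R
  open OrderedFieldProperties R
  open Germs R
  open ≤-Reasoning

  -- Coefficient lists start with the leading coefficient.
  ⟦_⟧ : List Carrier → Carrier → Carrier
  ⟦ [] ⟧     x = 0#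
  ⟦ c ∷ cs ⟧ x = c * x ^ length cs + ⟦ cs ⟧ x

  fromℕ : ℕ → Carrier
  fromℕ zero    = 0#
  fromℕ (suc n) = fromℕ n + 1#

  deriv : List Carrier → List Carrier
  deriv []           = []
  deriv (c ∷ [])     = []
  deriv (c ∷ b ∷ bs) = fromℕ (length (b ∷ bs)) * c ∷ deriv (b ∷ bs)

  -- Horner's synthetic division by x - a. The second argument is the running Horner value; the last
  -- one, which is the remainder, is dropped.
  quotient : Carrier → Carrier → List Carrier → List Carrier
  quotient a c []       = []
  quotient a c (b ∷ bs) = c ∷ quotient a (c * a + b) bs

  length-deriv : ∀ c cs → length (deriv (c ∷ cs)) ≡ length cs
  length-deriv c []       = ≡.refl
  length-deriv c (b ∷ bs) = ≡.cong suc (length-deriv b bs)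

  length-quotient : ∀ a c cs → length (quotient a c cs) ≡ length cs
  length-quotient a c []       = ≡.refl
  length-quotient a c (b ∷ bs) = ≡.cong suc (length-quotient a (c * a + b) bs)

  -- Carathéodory's form of the derivative: the difference quotient extends continuously to `a`,
  -- with value `s`. The product rule becomes an algebraic identity and uniqueness a case of
  -- `vanishing`.
  Slope : (Carrier → Carrier) → Carrier → Carrier → Set
  Slope F a s = ∃[ K ] LipschitzAt K a × (∀ x → F x ≈ F a + (x - a) * K x) × K a ≈ s

  opaque

    lipschitz-⟦⟧ : ∀ {a} cs → LipschitzAt ⟦ cs ⟧ a
    lipschitz-⟦⟧ []       = lipschitz-const 0#
    lipschitz-⟦⟧ (c ∷ cs) = lipschitz-+
      (lipschitz-* (lipschitz-const c) (lipschitz-^ (length cs) lipschitz-id)) (lipschitz-⟦⟧ cs)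

    quotient-remainder : ∀ a c cs x →
      ⟦ c ∷ cs ⟧ x ≈ (x - a) * ⟦ quotient a c cs ⟧ x + ⟦ c ∷ cs ⟧ a
    quotient-remainder a c [] x =
      solve 3 (λ a c x → c :* con (+ 1) :+ con (+ 0) :=
        (x :- a) :* con (+ 0) :+ (c :* con (+ 1) :+ con (+ 0))) refl a c x
    quotient-remainder a c (b ∷ bs) x rewrite length-quotient a (c * a + b) bs = begin-equality
      c * (x * X) + (b * X + F)                  ≈⟨ solve 6 (λ a b c x X F →
                                                      c :* (x :* X) :+ (b :* X :+ F) :=
                                                      (x :- a) :* (c :* X) :+ ((c :* a :+ b) :* X :+ F))
                                                      refl a b c x X F ⟩
      (x - a) * (c * X) + ((c * a + b) * X + F)  ≈⟨ +-congˡ (quotient-remainder a (c * a + b) bs x) ⟩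
      (x - a) * (c * X) + ((x - a) * Q + ((c * a + b) * A + G))
                                                 ≈⟨ solve 8 (λ d c X Q a b A G →
                                                      d :* (c :* X) :+ (d :* Q :+ ((c :* a :+ b) :* A :+ G)) :=
                                                      d :* (c :* X :+ Q) :+ (c :* (a :* A) :+ (b :* A :+ G)))
                                                      refl (x - a) c X Q a b A G ⟩
      (x - a) * (c * X + Q) + (c * (a * A) + (b * A + G)) ∎
      where
      X F Q A G : Carrier
      X = x ^ length bs
      F = ⟦ bs ⟧ x
      Q = ⟦ quotient a (c * a + b) bs ⟧ x
      A = a ^ length bs
      G = ⟦ bs ⟧ a

    slope-cong : ∀ {F a s t} → s ≈ t → Slope F a s → Slope F a t
    slope-cong s≈t (K , LK , F≈ , Ka≈s) = K , LK , F≈ , trans Ka≈s s≈t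

    slope-const : ∀ {a} c → Slope (λ _ → c) a 0#
    slope-const {a} c = (λ _ → 0#) , lipschitz-const 0# ,
      (λ x → solve 3 (λ c x a → c := c :+ (x :- a) :* con (+ 0)) refl c x a) , refl

    slope-shift : ∀ {a} b → Slope (λ x → x - b) a 1#
    slope-shift {a} b = (λ _ → 1#) , lipschitz-const 1# ,
      (λ x → solve 3 (λ x a b → x :- b := a :- b :+ (x :- a) :* con (+ 1)) refl x a b) , refl

    slope-id : ∀ {a} → Slope (λ x → x) a 1#
    slope-id {a} = (λ _ → 1#) , lipschitz-const 1# ,
      (λ x → solve 2 (λ x a → x := a :+ (x :- a) :* con (+ 1)) refl x a) , refl

    slope-+ : ∀ {F G a s t} → Slope F a s → Slope G a t → Slope (λ x → F x + G x) a (s + t)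
    slope-+ {F} {G} {a} (K , LK , F≈ , Ka≈s) (L , LL , G≈ , La≈t) =
      (λ x → K x + L x) , lipschitz-+ LK LL ,
      (λ x → trans (+-cong (F≈ x) (G≈ x))
        (solve 5 (λ f g d k l → (f :+ d :* k) :+ (g :+ d :* l) := (f :+ g) :+ d :* (k :+ l)) refl
          (F a) (G a) (x - a) (K x) (L x))) ,
      +-cong Ka≈s La≈t

    slope-* : ∀ {F G a s t} → LipschitzAt G a → Slope F a s → Slope G a t →
              Slope (λ x → F x * G x) a (s * G a + F a * t)
    slope-* {F} {G} {a} LG (K , LK , F≈ , Ka≈s) (L , LL , G≈ , La≈t) =
      (λ x → K x * G x + F a * L x) ,
      lipschitz-+ (lipschitz-* LK LG) (lipschitz-* (lipschitz-const (F a)) LL) ,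
      (λ x → begin-equality
        F x * G x                                            ≈⟨ *-congʳ (F≈ x) ⟩
        (F a + (x - a) * K x) * G x                          ≈⟨ solve 4 (λ f d k g → (f :+ d :* k) :* g :=
                                                                  f :* g :+ d :* k :* g) refl
                                                                  (F a) (x - a) (K x) (G x) ⟩
        F a * G x + (x - a) * K x * G x                      ≈⟨ +-congʳ (*-congˡ (G≈ x)) ⟩
        F a * (G a + (x - a) * L x) + (x - a) * K x * G x    ≈⟨ solve 6 (λ f d k g h l →
                                                                  f :* (h :+ d :* l) :+ d :* k :* g :=
                                                                  f :* h :+ d :* (k :* g :+ f :* l)) refl
                                                                  (F a) (x - a) (K x) (G x) (G a) (L x) ⟩
        F a * G a + (x - a) * (K x * G x + F a * L x)        ∎) ,
      +-cong (*-congʳ Ka≈s) (*-congˡ La≈t)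

    slope-^ : ∀ {a} n → Slope (λ x → x ^ suc n) a (fromℕ (suc n) * a ^ n)
    slope-^ {a} zero = slope-cong
      (solve 1 (λ a → con (+ 1) :* con (+ 1) :+ a :* con (+ 0) := (con (+ 0) :+ con (+ 1)) :* con (+ 1)) refl a)
      (slope-* (lipschitz-const 1#) slope-id (slope-const 1#))
    slope-^ {a} (suc n) = slope-cong
      (solve 3 (λ a A k → con (+ 1) :* (a :* A) :+ a :* (k :* A) := (k :+ con (+ 1)) :* (a :* A)) refl
        a (a ^ n) (fromℕ (suc n)))
      (slope-* (lipschitz-^ (suc n) lipschitz-id) slope-id (slope-^ n))

    slope-⟦⟧ : ∀ {a} cs → Slope ⟦ cs ⟧ a (⟦ deriv cs ⟧ a)
    slope-⟦⟧ []           = slope-const 0#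
    slope-⟦⟧ {a} (c ∷ []) = slope-const {a} (c * 1# + 0#)
    slope-⟦⟧ {a} (c ∷ b ∷ bs) = slope-cong
      (+-congʳ head) (slope-+
        (slope-* (lipschitz-^ (suc (length bs)) lipschitz-id) (slope-const c) (slope-^ (length bs)))
        (slope-⟦⟧ (b ∷ bs)))
      where
      head : 0# * a ^ suc (length bs) + c * (fromℕ (suc (length bs)) * a ^ length bs) ≈
             fromℕ (suc (length bs)) * c * a ^ length (deriv (b ∷ bs))
      head rewrite length-deriv b bs =
        solve 4 (λ c A k B → con (+ 0) :* B :+ c :* (k :* A) := k :* c :* A) refl
          c (a ^ length bs) (fromℕ (suc (length bs))) (a ^ suc (length bs))

    slope-unique : ∀ {F G a s t} → (∀ x → F x ≈ G x) → Slope F a s → Slope G a t → s ≈ t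
    slope-unique {F} {G} {a} {s} {t} F≈G (K , LK , F≈ , Ka≈s) (L , LL , G≈ , La≈t) = begin-equality
      s              ≈⟨ Ka≈s ⟨
      K a            ≈⟨ solve 2 (λ k l → k := k :- l :+ l) refl (K a) (L a) ⟩
      K a - L a + L a  ≈⟨ +-congʳ (vanishing (lipschitz-+ LK (lipschitz-neg LL)) K≈L) ⟩
      0# + L a       ≈⟨ +-identityˡ (L a) ⟩
      L a            ≈⟨ La≈t ⟩
      t              ∎
      where
      K≈L : ∀ x → ¬ (x ≈ a) → K x - L x ≈ 0#
      K≈L x x≉a = *-cancelˡ-≉0 (λ x-a≈0 → x≉a (begin-equality
          x          ≈⟨ solve 2 (λ x a → x := x :- a :+ a) refl x a ⟩
          x - a + a  ≈⟨ +-congʳ x-a≈0 ⟩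
          0# + a     ≈⟨ +-identityˡ a ⟩
          a          ∎)) (begin-equality
        (x - a) * (K x - L x)                                ≈⟨ solve 5 (λ d k l f g → d :* (k :- l) :=
                                                                  (f :+ d :* k) :- (g :+ d :* l) :- (f :- g)) refl
                                                                  (x - a) (K x) (L x) (F a) (G a) ⟩
        (F a + (x - a) * K x) - (G a + (x - a) * L x) - (F a - G a)
                                                             ≈⟨ +-cong (+-cong (F≈ x) (-‿cong (G≈ x))) (-‿cong (+-congʳ (sym (F≈G a)))) ⟨
        F x - G x - (G a - G a)                              ≈⟨ +-congʳ (+-congʳ (F≈G x)) ⟩
        G x - G x - (G a - G a)
          ≈⟨ solve 3 (λ g h d → g :- g :- (h :- h) := d :* con (+ 0)) refl (G x) (G a) (x - a) ⟩
        (x - a) * 0#                                         ∎)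

  data Factorisation (a : Carrier) : List Carrier → Set where
    unit  : ∀ {cs} → ¬ (⟦ cs ⟧ a ≈ 0#) → Factorisation a cs
    shift : ∀ {cs ds} → (∀ x → ⟦ cs ⟧ x ≈ (x - a) * ⟦ ds ⟧ x) → Factorisation a ds → Factorisation a cs

  multiplicity : ∀ {a cs} → Factorisation a cs → ℕ
  multiplicity (unit _)    = 0
  multiplicity (shift _ f) = suc (multiplicity f)

  cofactor : ∀ {a cs} → Factorisation a cs → List Carrier
  cofactor {cs = cs} (unit _) = cs
  cofactor (shift _ f)        = cofactor f

  cofactor≉0 : ∀ {a cs} (f : Factorisation a cs) → ¬ (⟦ cofactor f ⟧ a ≈ 0#)
  cofactor≉0 (unit c≉0)  = c≉0
  cofactor≉0 (shift _ f) = cofactor≉0 f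

  factorisation-≈ : ∀ {a cs} (f : Factorisation a cs) x →
                    ⟦ cs ⟧ x ≈ (x - a) ^ multiplicity f * ⟦ cofactor f ⟧ x
  factorisation-≈ (unit _) x     = sym (*-identityˡ _)
  factorisation-≈ (shift cs≈ f) x = trans (cs≈ x) (trans (*-congˡ (factorisation-≈ f x)) (sym (*-assoc _ _ _)))

  factorise : ∀ a {c} cs → ¬ (c ≈ 0#) → Factorisation a (c ∷ cs)
  factorise a {c} cs = go (length cs) c cs ≡.refl
    where
    -- The degree serves as fuel, since a quotient is no sublist. Its leading coefficient is still
    -- `c`, so the descent ends at the latest at a nonzero constant.
    go : ∀ n c cs → length cs ≡ n → ¬ (c ≈ 0#) → Factorisation a (c ∷ cs)
    go zero c [] _ c≉0 = unit λ c≈0 → c≉0 (trans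
      (solve 1 (λ c → c := c :* con (+ 1) :+ con (+ 0)) refl c) c≈0)
    go (suc n) c (b ∷ bs) len c≉0 with <-cmp (⟦ c ∷ b ∷ bs ⟧ a) 0#
    ... | tri< _ ≉0 _ = unit ≉0
    ... | tri> _ ≉0 _ = unit ≉0
    ... | tri≈ _ ≈0 _ = shift
      (λ x → trans (quotient-remainder a c (b ∷ bs) x) (trans (+-congˡ ≈0) (+-identityʳ _)))
      (go n c (quotient a (c * a + b) bs)
        (≡.trans (length-quotient a (c * a + b) bs) (ℕ.suc-injective len)) c≉0)

  opaque

    -- The hypothesis equates values, not coefficients, so the derivatives are not compared term by
    -- term. At each x both sides are slopes of the same function, the right one by the product
    -- rule.
    deriv-shift : ∀ {a cs ds} → (∀ x → ⟦ cs ⟧ x ≈ (x - a) * ⟦ ds ⟧ x) →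
                  ∀ x → ⟦ deriv cs ⟧ x ≈ ⟦ ds ⟧ x + (x - a) * ⟦ deriv ds ⟧ x
    deriv-shift {a} {cs} {ds} cs≈ x = slope-unique cs≈ (slope-⟦⟧ cs)
      (slope-cong (+-congʳ (*-identityˡ _)) (slope-* (lipschitz-⟦⟧ ds) (slope-shift a) (slope-⟦⟧ ds)))

  -- By the product rule each factor x - a contributes one copy of the cofactor to `u a`. Hence `t`
  -- is the multiplicity of the root, recorded only as a positive number because only signs are
  -- compared afterwards.
  deriv-root : ∀ {a cs ds} (cs≈ : ∀ x → ⟦ cs ⟧ x ≈ (x - a) * ⟦ ds ⟧ x) (f : Factorisation a ds) →
    ∃[ u ] ∃[ t ] LipschitzAt u a × 0# < t × u a ≈ t * ⟦ cofactor f ⟧ a ×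
      (∀ x → ⟦ deriv cs ⟧ x ≈ (x - a) ^ multiplicity f * u x)
  deriv-root {a} {cs} {ds} cs≈ (unit _) =
    (λ x → ⟦ ds ⟧ x + (x - a) * ⟦ deriv ds ⟧ x) , 1# ,
    lipschitz-+ (lipschitz-⟦⟧ ds) (lipschitz-* (lipschitz-shift a) (lipschitz-⟦⟧ (deriv ds))) , 0<1 ,
    solve 3 (λ h a d → h :+ (a :- a) :* d := con (+ 1) :* h) refl (⟦ ds ⟧ a) a (⟦ deriv ds ⟧ a) ,
    λ x → trans (deriv-shift {cs = cs} {ds} cs≈ x) (sym (*-identityˡ _))
  deriv-root {a} {cs} {ds} cs≈ (shift {ds = es} ds≈ f)
    with u , t , Lu , 0<t , ua≈ , ds′≈ ← deriv-root {cs = ds} {es} ds≈ f =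
    (λ x → ⟦ cofactor f ⟧ x + u x) , 1# + t , lipschitz-+ (lipschitz-⟦⟧ (cofactor f)) Lu , +-positive 0<1 (<⇒≤ 0<t) ,
    trans (+-congˡ ua≈) (solve 2 (λ h t → h :+ t :* h := (con (+ 1) :+ t) :* h) refl (⟦ cofactor f ⟧ a) t) ,
    λ x → begin-equality
      ⟦ deriv cs ⟧ x                                     ≈⟨ deriv-shift {cs = cs} {ds} cs≈ x ⟩
      ⟦ ds ⟧ x + (x - a) * ⟦ deriv ds ⟧ x
        ≈⟨ +-cong (factorisation-≈ (shift {cs = ds} {es} ds≈ f) x) (*-congˡ (ds′≈ x)) ⟩
      (x - a) * (x - a) ^ multiplicity f * ⟦ cofactor f ⟧ x + (x - a) * ((x - a) ^ multiplicity f * u x)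
                                                         ≈⟨ solve 4 (λ d D h u → d :* D :* h :+ d :* (D :* u) := d :* D :* (h :+ u)) refl
                                                              (x - a) ((x - a) ^ multiplicity f) (⟦ cofactor f ⟧ x) (u x) ⟩
      (x - a) * (x - a) ^ multiplicity f * (⟦ cofactor f ⟧ x + u x) ∎

-- Signs of polynomials near the two infinities

module Infinity (R : CompleteOrderedField) where

  open CompleteOrderedField R
  open OrderedFieldProperties R
  open Germs R
  open Polynomials R
  open ≤-Reasoning

  Top Bottom : ∀ {V : Set} → (Carrier → V) → V → Set
  Top    φ v = ∃[ B ] (∀ {x} → B < x → φ x ≡ v)
  Bottom φ v = ∃[ B ] (∀ {x} → x < B → φ x ≡ v)

  module _ {U V W : Set} (f : U → V → W) where

    Top-zip : ∀ {φ ψ v w} → Top φ v → Top ψ w → Top (λ x → f (φ x) (ψ x)) (f v w)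
    Top-zip (A , φ≡) (B , ψ≡) with C , A≤C , B≤C ← above A B
      = C , λ C<x → ≡.cong₂ f (φ≡ (≤-<-trans A≤C C<x)) (ψ≡ (≤-<-trans B≤C C<x))

    Bottom-zip : ∀ {φ ψ v w} → Bottom φ v → Bottom ψ w → Bottom (λ x → f (φ x) (ψ x)) (f v w)
    Bottom-zip (A , φ≡) (B , ψ≡) with C , C≤A , C≤B ← under A B
      = C , λ x<C → ≡.cong₂ f (φ≡ (<-≤-trans x<C C≤A)) (ψ≡ (<-≤-trans x<C C≤B))

  -- The reciprocal polynomial: p x is x^n times its value at 1 / x, where n is the degree. Signs at
  -- infinity thus become signs near 0, where its value is the leading coefficient.
  reversed : List Carrier → Carrier → Carrier
  reversed []       y = 0#
  reversed (c ∷ cs) y = c + y * reversed cs y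

  opaque

    lipschitz-reversed : ∀ {a} cs → LipschitzAt (reversed cs) a
    lipschitz-reversed []       = lipschitz-const 0#
    lipschitz-reversed (c ∷ cs) =
      lipschitz-+ (lipschitz-const c) (lipschitz-* lipschitz-id (lipschitz-reversed cs))

    reversed-0 : ∀ c cs → reversed (c ∷ cs) 0# ≈ c
    reversed-0 c cs = solve 2 (λ c r → c :+ con (+ 0) :* r := c) refl c (reversed cs 0#)

    ⟦⟧-reversed : ∀ {x y} → x * y ≈ 1# → ∀ c cs →
                  ⟦ c ∷ cs ⟧ x ≈ x ^ length cs * reversed (c ∷ cs) y
    ⟦⟧-reversed {x} {y} xy≈1 c [] =
      solve 2 (λ c y → c :* con (+ 1) :+ con (+ 0) := con (+ 1) :* (c :+ y :* con (+ 0))) refl c y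
    ⟦⟧-reversed {x} {y} xy≈1 c (b ∷ bs) = begin-equality
      c * (x * X) + ⟦ b ∷ bs ⟧ x              ≈⟨ +-congˡ (⟦⟧-reversed xy≈1 b bs) ⟩
      c * (x * X) + X * S                     ≈⟨ +-congˡ (*-identityˡ _) ⟨
      c * (x * X) + 1# * (X * S)              ≈⟨ +-congˡ (*-congʳ xy≈1) ⟨
      c * (x * X) + x * y * (X * S)           ≈⟨ solve 5 (λ c x y X S → c :* (x :* X) :+ x :* y :* (X :* S) :=
                                                   x :* X :* (c :+ y :* S)) refl c x y X S ⟩
      x * X * (c + y * S)                     ∎
      where
      X S : Carrier
      X = x ^ length bs
      S = reversed (b ∷ bs) y

    inverse-positive : ∀ {x y} → x * y ≈ 1# → 0# < x → 0# < y
    inverse-positive xy≈1 0<x = positive-factor 0<x (<-respʳ-≈ (sym xy≈1) 0<1)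

    inverse-negative : ∀ {x y} → x * y ≈ 1# → x < 0# → y < 0#
    inverse-negative {x} {y} xy≈1 x<0 = 0<-⇒< (<-respʳ-≈ (sym (+-identityˡ (- y)))
      (inverse-positive (trans (solve 2 (λ x y → :- x :* :- y := x :* y) refl x y) xy≈1) (neg-positive x<0)))

    inverse-< : ∀ {r r⁻¹ x y} → r * r⁻¹ ≈ 1# → x * y ≈ 1# → 0# < r → 0# < x → r⁻¹ < x → y < r
    inverse-< {r} {r⁻¹} {x} {y} rr⁻¹≈1 xy≈1 0<r 0<x r⁻¹<x = 0<-⇒< (positive-factor 0<x (begin-strict
      0#                   <⟨ *-positive 0<r (<⇒0<- r⁻¹<x) ⟩
      r * (x - r⁻¹)        ≈⟨ solve 3 (λ r s x → r :* (x :- s) := x :* r :- r :* s) refl r r⁻¹ x ⟩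
      x * r - r * r⁻¹      ≈⟨ +-congˡ (-‿cong (trans rr⁻¹≈1 (sym xy≈1))) ⟩
      x * r - x * y        ≈⟨ solve 3 (λ x r y → x :* r :- x :* y := x :* (r :- y)) refl x r y ⟩
      x * (r - y)          ∎))

    inverse->-negative : ∀ {l l⁻¹ x y} → l * l⁻¹ ≈ 1# → x * y ≈ 1# → l < 0# → x < 0# → x < l⁻¹ → l < y
    inverse->-negative {l} {l⁻¹} {x} {y} ll⁻¹≈1 xy≈1 l<0 x<0 x<l⁻¹ =
      0<-⇒< (positive-factor (neg-positive x<0) (begin-strict
        0#                   <⟨ *-positive (neg-positive l<0) (<⇒0<- x<l⁻¹) ⟩
        - l * (l⁻¹ - x)      ≈⟨ solve 3 (λ l s x → :- l :* (s :- x) := x :* l :- l :* s) refl l l⁻¹ x ⟩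
        x * l - l * l⁻¹      ≈⟨ +-congˡ (-‿cong (trans ll⁻¹≈1 (sym xy≈1))) ⟩
        x * l - x * y        ≈⟨ solve 3 (λ x l y → x :* l :- x :* y := :- x :* (y :- l)) refl x l y ⟩
        - x * (y - l)        ∎))

  module _ {c : Carrier} (cs : List Carrier) (c≉0 : ¬ (c ≈ 0#)) where

    private
      near = sgn-near {a = 0#} (lipschitz-reversed (c ∷ cs)) (λ r≈0 → c≉0 (trans (sym (reversed-0 c cs)) r≈0))

    sgn-top : Top (sgn ∘ ⟦ c ∷ cs ⟧) (sgn c)
    sgn-top
      with l , r , l<0 , 0<r , sgn≡ ← near
      with r⁻¹ , rr⁻¹≈1 ← invertible (>⇒≉ 0<r)
      = r⁻¹ , λ {x} r⁻¹<x → at x r⁻¹<x (<-trans (inverse-positive rr⁻¹≈1 0<r) r⁻¹<x)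
      where
      at : ∀ x → r⁻¹ < x → 0# < x → sgn (⟦ c ∷ cs ⟧ x) ≡ sgn c
      at x r⁻¹<x 0<x with y , xy≈1 ← invertible (>⇒≉ 0<x) =
        ≡.trans (sgn-cong (⟦⟧-reversed xy≈1 c cs)) (
        ≡.trans (sgn-^-positive (length cs) _ 0<x) (
        ≡.trans (sgn≡ (<-trans l<0 (inverse-positive xy≈1 0<x)) (inverse-< rr⁻¹≈1 xy≈1 0<r 0<x r⁻¹<x))
                (sgn-cong (reversed-0 c cs))))

    sgn-bottom : Bottom (sgn ∘ ⟦ c ∷ cs ⟧) (flip (length cs) (sgn c))
    sgn-bottom
      with l , r , l<0 , 0<r , sgn≡ ← near
      with l⁻¹ , ll⁻¹≈1 ← invertible (<⇒≉ l<0)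
      = l⁻¹ , λ {x} x<l⁻¹ → at x x<l⁻¹ (<-trans x<l⁻¹ (inverse-negative ll⁻¹≈1 l<0))
      where
      at : ∀ x → x < l⁻¹ → x < 0# → sgn (⟦ c ∷ cs ⟧ x) ≡ flip (length cs) (sgn c)
      at x x<l⁻¹ x<0 with y , xy≈1 ← invertible (<⇒≉ x<0) =
        ≡.trans (sgn-cong (⟦⟧-reversed xy≈1 c cs)) (
        ≡.trans (sgn-^-negative (length cs) _ x<0) (≡.cong (flip (length cs)) (
        ≡.trans (sgn≡ (inverse->-negative ll⁻¹≈1 xy≈1 l<0 x<0 x<l⁻¹) (<-trans (inverse-negative xy≈1 x<0) 0<r))
                (sgn-cong (reversed-0 c cs)))))

-- Cauchy indices: reduction and reciprocity

module CauchyIndex (R : CompleteOrderedField) where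

  open CompleteOrderedField R
  open OrderedFieldProperties R
  open Germs R
  open Polynomials R
  open Infinity R
  open Algebra.Properties.Semiring.Exp semiring using (^-homo-*)
  open Data.Integer.Solver.+-*-Solver using ()
    renaming (solve to ℤ-solve; _:=_ to _⊜_; _:+_ to _⊕_; _:-_ to _⊖_)
  open ≤-Reasoning

  -- Jump a D N i says that i is the jump of sgn (N / D) at a, counted only if
  -- N / D has a pole there.
  data Jump (a : Carrier) (D N : Carrier → Carrier) : ℤ → Set where
    regular : ∀ n {h u} → LipschitzAt h a → ¬ (h a ≈ 0#) → LipschitzAt u a →
              (∀ x → D x ≈ (x - a) ^ n * h x) → (∀ x → N x ≈ (x - a) ^ n * u x) →
              Jump a D N ℤ.0ℤ
    pole    : ∀ k n {h u} → LipschitzAt h a → ¬ (h a ≈ 0#) → LipschitzAt u a → ¬ (u a ≈ 0#) →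
              (∀ x → D x ≈ (x - a) ^ (suc k ℕ.+ n) * h x) → (∀ x → N x ≈ (x - a) ^ n * u x) →
              Jump a D N (sgn (h a * u a) ℤ.- flip ((suc k ℕ.+ n) ℕ.+ n) (sgn (h a * u a)))

  -- φ is a step function with the jumps of N / D, so that its total rise j is twice
  -- the Cauchy index.
  record Index (D N : Carrier → Carrier) (j : ℤ) : Set where
    field
      φ      : Carrier → ℤ
      lo hi  : ℤ
      bottom : Bottom φ lo
      top    : Top φ hi
      total  : hi ≡ lo ℤ.+ j
      jump   : ∀ {a i} → Jump a D N i → ∃[ l ] Left φ a l × Right φ a (l ℤ.+ i)

  opaque

    a-a^≈0 : ∀ a k → (a - a) ^ suc k ≈ 0#
    a-a^≈0 a k = trans (*-congʳ (-‿inverseʳ a)) (zeroˡ _)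

    ^-≉0 : ∀ {x} n → ¬ (x ≈ 0#) → ¬ (x ^ n ≈ 0#)
    ^-≉0 zero    x≉0 = >⇒≉ 0<1
    ^-≉0 (suc n) x≉0 = ≉0-* x≉0 (^-≉0 n x≉0)

    x-a≉0 : ∀ {x a} → ¬ (x ≈ a) → ¬ (x - a ≈ 0#)
    x-a≉0 {x} {a} x≉a x-a≈0 = x≉a (begin-equality
      x          ≈⟨ solve 2 (λ x a → x := x :- a :+ a) refl x a ⟩
      x - a + a  ≈⟨ +-congʳ x-a≈0 ⟩
      0# + a     ≈⟨ +-identityˡ a ⟩
      a          ∎)

    -- Dividing by (x - a)^n away from `a` and passing to `a` by continuity gives w a = 0^(k+1) u a.
    -- So a cofactor that is nonzero at `a` determines the order of vanishing.
    order-unique : ∀ {a u w} k n → LipschitzAt u a → LipschitzAt w a →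
      (∀ x → (x - a) ^ n * w x ≈ (x - a) ^ (suc k ℕ.+ n) * u x) → w a ≈ 0#
    order-unique {a} {u} {w} k n Lu Lw eq = begin-equality
      w a
        ≈⟨ solve 3 (λ w z u → w := w :- z :* u :+ z :* u) refl (w a) ((a - a) ^ suc k) (u a) ⟩
      w a - (a - a) ^ suc k * u a + (a - a) ^ suc k * u a
                                       ≈⟨ +-cong (vanishing (lipschitz-+ Lw (lipschitz-neg
                                            (lipschitz-* (lipschitz-^ (suc k) (lipschitz-shift a)) Lu))) off)
                                            (*-congʳ (a-a^≈0 a k)) ⟩
      0# + 0# * u a                    ≈⟨ solve 1 (λ u → con (+ 0) :+ con (+ 0) :* u := con (+ 0)) refl (u a) ⟩
      0#                               ∎
      where
      off : ∀ x → ¬ (x ≈ a) → w x - (x - a) ^ suc k * u x ≈ 0#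
      off x x≉a = *-cancelˡ-≉0 (^-≉0 n (x-a≉0 x≉a)) (begin-equality
        (x - a) ^ n * (w x - (x - a) ^ suc k * u x)
          ≈⟨ solve 4 (λ D w z u → D :* (w :- z :* u) := D :* w :- z :* D :* u) refl
               ((x - a) ^ n) (w x) ((x - a) ^ suc k) (u x) ⟩
        (x - a) ^ n * w x - (x - a) ^ suc k * (x - a) ^ n * u x
          ≈⟨ +-congˡ (-‿cong (*-congʳ (^-homo-* (x - a) (suc k) n))) ⟨
        (x - a) ^ n * w x - (x - a) ^ (suc k ℕ.+ n) * u x
          ≈⟨ +-congʳ (eq x) ⟩
        (x - a) ^ (suc k ℕ.+ n) * u x - (x - a) ^ (suc k ℕ.+ n) * u x
          ≈⟨ solve 2 (λ y D → y :- y := D :* con (+ 0)) refl _ ((x - a) ^ n) ⟩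
        (x - a) ^ n * 0# ∎)

    -- The cofactor of D is untouched. At a pole the cofactor of N changes by a multiple of (x -
    -- a)^(k+1), which vanishes at `a`, so the sign that defines the jump is preserved.
    jump-reduce : ∀ {a D N N′ P i} → LipschitzAt P a → (∀ x → N x ≈ N′ x + P x * D x) →
                  Jump a D N i → Jump a D N′ i
    jump-reduce {a} {D} {N} {N′} {P} LP N≈ (regular n {h} {u} Lh h≉0 Lu D≈ Nu≈) =
      regular n Lh h≉0 (lipschitz-+ Lu (lipschitz-neg (lipschitz-* LP Lh))) D≈ λ x → begin-equality
        N′ x
          ≈⟨ solve 2 (λ m p → m := m :+ p :- p) refl (N′ x) (P x * D x) ⟩
        N′ x + P x * D x - P x * D x                  ≈⟨ +-cong (N≈ x) (-‿cong (*-congˡ (sym (D≈ x)))) ⟨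
        N x - P x * ((x - a) ^ n * h x)               ≈⟨ +-congʳ (Nu≈ x) ⟩
        (x - a) ^ n * u x - P x * ((x - a) ^ n * h x)
          ≈⟨ solve 4 (λ D u p h → D :* u :- p :* (D :* h) := D :* (u :- p :* h)) refl
                                                           ((x - a) ^ n) (u x) (P x) (h x) ⟩
        (x - a) ^ n * (u x - P x * h x)               ∎
    jump-reduce {a} {D} {N} {N′} {P} LP N≈ (pole k n {h} {u} Lh h≉0 Lu u≉0 D≈ Nu≈) =
      ≡.subst (λ s → Jump a D N′ (s ℤ.- flip ((suc k ℕ.+ n) ℕ.+ n) s)) (sgn-cong (*-congˡ u′a≈ua))
        (pole k n Lh h≉0
          (lipschitz-+ Lu (lipschitz-neg (lipschitz-* (lipschitz-* LP (lipschitz-^ (suc k) (lipschitz-shift a))) Lh)))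
          (λ u′a≈0 → u≉0 (trans (sym u′a≈ua) u′a≈0)) D≈ λ x → begin-equality
            N′ x
              ≈⟨ solve 2 (λ m p → m := m :+ p :- p) refl (N′ x) (P x * D x) ⟩
            N′ x + P x * D x - P x * D x                  ≈⟨ +-cong (N≈ x) (-‿cong (*-congˡ (sym (D≈ x)))) ⟨
            N x - P x * ((x - a) ^ (suc k ℕ.+ n) * h x)
              ≈⟨ +-cong (Nu≈ x) (-‿cong (*-congˡ (*-congʳ (^-homo-* (x - a) (suc k) n)))) ⟩
            (x - a) ^ n * u x - P x * ((x - a) ^ suc k * (x - a) ^ n * h x)
                                                          ≈⟨ solve 5 (λ D u p z h → D :* u :- p :* (z :* D :* h) := D :* (u :- p :* z :* h)) refl
                                                               ((x - a) ^ n) (u x) (P x) ((x - a) ^ suc k) (h x) ⟩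
            (x - a) ^ n * (u x - P x * (x - a) ^ suc k * h x) ∎)
      where
      u′a≈ua : u a - P a * (a - a) ^ suc k * h a ≈ u a
      u′a≈ua = trans (+-congˡ (-‿cong (*-congʳ (*-congˡ (a-a^≈0 a k)))))
        (solve 3 (λ u p h → u :- p :* con (+ 0) :* h := u) refl (u a) (P a) (h a))

    product-≈ : ∀ {D N h u : Carrier → Carrier} {a} m n →
      (∀ x → D x ≈ (x - a) ^ m * h x) → (∀ x → N x ≈ (x - a) ^ n * u x) →
      ∀ x → D x * N x ≈ (x - a) ^ (m ℕ.+ n) * (h x * u x)
    product-≈ {h = h} {u} {a} m n D≈ N≈ x = begin-equality
      _                                          ≈⟨ *-cong (D≈ x) (N≈ x) ⟩
      (x - a) ^ m * h x * ((x - a) ^ n * u x)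
        ≈⟨ solve 4 (λ A h B u → A :* h :* (B :* u) := A :* B :* (h :* u)) refl
                                                      ((x - a) ^ m) (h x) ((x - a) ^ n) (u x) ⟩
      (x - a) ^ m * (x - a) ^ n * (h x * u x)    ≈⟨ *-congʳ (^-homo-* (x - a) m n) ⟨
      (x - a) ^ (m ℕ.+ n) * (h x * u x)          ∎

  SwappedJump : (a : Carrier) (D N : Carrier → Carrier) → ℤ → Set
  SwappedJump a D N i = ∃[ i′ ] Jump a N D i′ × (∃[ l ] Left (λ x → sgn (D x * N x)) a l
                                                 × Right (λ x → sgn (D x * N x)) a (l ℤ.+ (i ℤ.+ i′)))

  module _ {a : Carrier} {D N h u : Carrier → Carrier} (m n : ℕ)
           (Lh : LipschitzAt h a) (h≉0 : ¬ (h a ≈ 0#)) (Lu : LipschitzAt u a) (u≉0 : ¬ (u a ≈ 0#))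
           (D≈ : ∀ x → D x ≈ (x - a) ^ m * h x) (N≈ : ∀ x → N x ≈ (x - a) ^ n * u x) where

    private
      σ = sgn (h a * u a)

    product-left : Left (λ x → sgn (D x * N x)) a (flip (m ℕ.+ n) σ)
    product-left = sgn-left (m ℕ.+ n) (product-≈ m n D≈ N≈) (lipschitz-* Lh Lu) (≉0-* h≉0 u≉0)

    product-right : Right (λ x → sgn (D x * N x)) a σ
    product-right = sgn-right (m ℕ.+ n) (product-≈ m n D≈ N≈) (lipschitz-* Lh Lu) (≉0-* h≉0 u≉0)

    product-germs : ∀ {i} → i ≡ σ ℤ.- flip (m ℕ.+ n) σ →
      ∃[ l ] Left (λ x → sgn (D x * N x)) a l × Right (λ x → sgn (D x * N x)) a (l ℤ.+ i)
    product-germs i≡ = flip (m ℕ.+ n) σ , product-left ,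
      ≡.subst (Right _ a) (≡.trans (ℤ-solve 2 (λ f s → s ⊜ f ⊕ (s ⊖ f)) ≡.refl (flip (m ℕ.+ n) σ) σ)
                                   (≡.cong (ℤ._+_ (flip (m ℕ.+ n) σ)) (≡.sym i≡))) product-right

  -- Local reciprocity: N / D and D / N both have the sign of D N, and at most one of them has a
  -- pole at `a`. A regular point does not record the exact order of N, as its `u` may vanish at
  -- `a`; factorising the coefficient list of N supplies it.
  jump-swap : ∀ {a D i} n ns → ¬ (n ≈ 0#) → Jump a D ⟦ n ∷ ns ⟧ i → SwappedJump a D ⟦ n ∷ ns ⟧ i
  jump-swap {a} n ns n≉0 (pole k e {h} {u} Lh h≉0 Lu u≉0 D≈ N≈) =
    ℤ.0ℤ ,
    regular e Lu u≉0 (lipschitz-* (lipschitz-^ (suc k) (lipschitz-shift a)) Lh) N≈ (λ x →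
      trans (D≈ x) (trans (*-congʳ (^-homo-* (x - a) (suc k) e))
        (solve 3 (λ z D h → z :* D :* h := D :* (z :* h)) refl ((x - a) ^ suc k) ((x - a) ^ e) (h x)))) ,
    product-germs (suc k ℕ.+ e) e Lh h≉0 Lu u≉0 D≈ N≈ (ℤ.+-identityʳ _)
  jump-swap {a} {D} n ns n≉0 (regular e {h} {u} Lh h≉0 Lu D≈ N≈) = go (ℕ.<-cmp m e)
    where
    fac = factorise a ns n≉0
    m = multiplicity fac
    w = ⟦ cofactor fac ⟧
    Lw = lipschitz-⟦⟧ {a} (cofactor fac)
    w≉0 = cofactor≉0 fac
    N≈w : ∀ x → ⟦ n ∷ ns ⟧ x ≈ (x - a) ^ m * w x
    N≈w = factorisation-≈ fac
    go : Tri (m ℕ.< e) (m ≡ e) (e ℕ.< m) → SwappedJump a D ⟦ n ∷ ns ⟧ ℤ.0ℤ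
    -- With equal orders D N has even order at `a`, so its sign does not jump.
    go (tri≈ _ m≡e _) = ℤ.0ℤ ,
      regular m Lw w≉0 Lh N≈w (≡.subst (λ e → ∀ x → D x ≈ (x - a) ^ e * h x) (≡.sym m≡e) D≈) ,
      product-germs e m Lh h≉0 Lw w≉0 D≈ N≈w (≡.sym (≡.trans (≡.cong (λ t → s ℤ.- t)
        (≡.trans (≡.cong (λ m → flip (e ℕ.+ m) s) m≡e) (flip-even e s))) (ℤ.+-inverseʳ s)))
      where s = sgn (h a * w a)
    go (tri< m<e _ _) with k , m+1+k≡e ← ℕ.≤⇒≤″ m<e =
      contradiction (order-unique k m Lu Lw λ x → begin-equality
        (x - a) ^ m * w x            ≈⟨ N≈w x ⟨
        ⟦ n ∷ ns ⟧ x                 ≈⟨ N≈ x ⟩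
        (x - a) ^ e * u x
          ≡⟨ ≡.cong (λ e → (x - a) ^ e * u x) (≡.trans (≡.sym m+1+k≡e) (≡.cong suc (ℕ.+-comm m k))) ⟩
        (x - a) ^ (suc k ℕ.+ m) * u x ∎) w≉0
    go (tri> _ _ e<m) with k , e+1+k≡m ← ℕ.≤⇒≤″ e<m =
      _ , pole k e Lw w≉0 Lh h≉0 N≈w′ D≈ ,
      product-germs e (suc k ℕ.+ e) Lh h≉0 Lw w≉0 D≈ N≈w′ (≡.trans (ℤ.+-identityˡ _)
        (≡.cong₂ (λ s k → s ℤ.- flip k s) (sgn-cong (*-comm (w a) (h a))) (ℕ.+-comm (suc k ℕ.+ e) e)))
      where
      N≈w′ : ∀ x → ⟦ n ∷ ns ⟧ x ≈ (x - a) ^ (suc k ℕ.+ e) * w x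
      N≈w′ x = ≡.subst (λ m → ⟦ n ∷ ns ⟧ x ≈ (x - a) ^ m * w x)
        (≡.trans (≡.sym e+1+k≡m) (≡.cong suc (ℕ.+-comm e k))) (N≈w x)

  open Index

  index-zero : ∀ {D N} → (∀ x → N x ≈ 0#) → Index D N ℤ.0ℤ
  index-zero {D} {N} N≈0 = record
    { φ      = λ _ → ℤ.0ℤ
    ; bottom = 0# , λ _ → ≡.refl
    ; top    = 0# , λ _ → ≡.refl
    ; total  = ≡.refl
    ; jump   = λ {a} J → ℤ.0ℤ , (a - 1# , x-1<x a , λ _ _ → ≡.refl) , (a + 1# , x<x+1 a , λ _ _ → ≡.sym (no-jump J))
    }
    where
    no-jump : ∀ {a i} → Jump a D N i → ℤ.0ℤ ℤ.+ i ≡ ℤ.0ℤ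
    no-jump (regular _ _ _ _ _ _) = ≡.refl
    no-jump {a} (pole k n Lh h≉0 Lu u≉0 D≈ N≈) = contradiction
      (vanishing Lu λ x x≉a → *-cancelˡ-≉0 (^-≉0 n (x-a≉0 x≉a))
        (trans (sym (N≈ x)) (trans (N≈0 x) (sym (zeroʳ _))))) u≉0

  index-reduce : ∀ {D N N′ P j} → (∀ {a} → LipschitzAt P a) → (∀ x → N x ≈ N′ x + P x * D x) →
                 Index D N′ j → Index D N j
  index-reduce LP N≈ I = record
    { φ = φ I ; bottom = bottom I ; top = top I ; total = total I
    ; jump = λ J → jump I (jump-reduce LP N≈ J)
    }

  index-cong : ∀ {D N N′ j} → (∀ x → N x ≈ N′ x) → Index D N′ j → Index D N j
  index-cong {D} N≈ = index-reduce {P = λ _ → 0#} (lipschitz-const 0#)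
    λ x → trans (N≈ x) (solve 2 (λ m d → m := m :+ con (+ 0) :* d) refl _ (D x))

  -- Global reciprocity: the sign of D N minus a step function for D / N jumps like N / D. At the
  -- two ends the sign of D N is read off the leading coefficients and the parity of the degrees,
  -- which gives the correction term.
  index-swap : ∀ {c n j} cs ns → ¬ (c ≈ 0#) → ¬ (n ≈ 0#) → Index ⟦ n ∷ ns ⟧ ⟦ c ∷ cs ⟧ j →
    let σ = sgn c ℤ.* sgn n in
    Index ⟦ c ∷ cs ⟧ ⟦ n ∷ ns ⟧ ((σ ℤ.- flip (length cs ℕ.+ length ns) σ) ℤ.- j)
  index-swap {c} {n} {j} cs ns c≉0 n≉0 I = record
    { φ = λ x → sgn (D x * N x) ℤ.- φ I x
    ; lo = flip e σ ℤ.- lo I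
    ; hi = σ ℤ.- hi I
    ; bottom = Bottom-zip ℤ._-_ (bottom′ (Bottom-zip ℤ._*_ (sgn-bottom cs c≉0) (sgn-bottom ns n≉0))) (bottom I)
    ; top = Top-zip ℤ._-_ (top′ (Top-zip ℤ._*_ (sgn-top cs c≉0) (sgn-top ns n≉0))) (top I)
    ; total = ≡.trans (≡.cong (ℤ._-_ σ) (total I))
        (ℤ-solve 4 (λ s f l j → s ⊖ (l ⊕ j) ⊜ (f ⊖ l) ⊕ ((s ⊖ f) ⊖ j)) ≡.refl σ (flip e σ) (lo I) j)
    ; jump = jump′
    }
    where
    D = ⟦ c ∷ cs ⟧
    N = ⟦ n ∷ ns ⟧
    e = length cs ℕ.+ length ns
    σ = sgn c ℤ.* sgn n
    product : ∀ x → sgn (D x * N x) ≡ sgn (D x) ℤ.* sgn (N x)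
    product x = sgn-* (D x) (N x)
    bottom′ : Bottom (λ x → sgn (D x) ℤ.* sgn (N x)) (flip (length cs) (sgn c) ℤ.* flip (length ns) (sgn n)) →
              Bottom (λ x → sgn (D x * N x)) (flip e σ)
    bottom′ (B , ≡v) = B , λ {x} x<B → ≡.trans (product x) (≡.trans (≡v x<B)
      (flip-* (length cs) (length ns) (sgn c) (sgn n)))
    top′ : Top (λ x → sgn (D x) ℤ.* sgn (N x)) σ → Top (λ x → sgn (D x * N x)) σ
    top′ (B , ≡v) = B , λ {x} B<x → ≡.trans (product x) (≡v B<x)
    jump′ : ∀ {a i} → Jump a D N i → ∃[ l ] Left (λ x → sgn (D x * N x) ℤ.- φ I x) a l ×
                                            Right (λ x → sgn (D x * N x) ℤ.- φ I x) a (l ℤ.+ i)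
    jump′ {a} {i} J
      with i′ , J′ , l , left , right ← jump-swap n ns n≉0 J
      with l′ , left′ , right′ ← jump I J′
      = l ℤ.- l′ , Left-zip ℤ._-_ left left′ , ≡.subst (Right _ a)
          (ℤ-solve 4 (λ l i k l′ → (l ⊕ (i ⊕ k)) ⊖ (l′ ⊕ k) ⊜ (l ⊖ l′) ⊕ i) ≡.refl l i i′ l′)
          (Right-zip ℤ._-_ right right′)

-- Sign queries at the roots of the derivative and the nonnegativity criterion

module TarskiQuery (R : CompleteOrderedField) where

  open CompleteOrderedField R
  open OrderedFieldProperties R
  open Germs R
  open Polynomials R
  open Infinity R
  open CauchyIndex R
  open Algebra.Properties.Ring ring using (-0#≈0#; -‿involutive)
  open Data.Integer.Solver.+-*-Solver using ()
    renaming (solve to ℤ-solve; _:=_ to _⊜_; _:+_ to _⊕_; _:-_ to _⊖_)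
  open ≤-Reasoning
  open Index

  module Sweep {V : Set} (φ : Carrier → V) (Q : V → Set) (stable : ∀ v → ¬ ¬ Q v → Q v)
    (germs : ∀ a → ∃[ v ] ∃[ w ] Left φ a v × Right φ a w × (Q v → Q w)) where

    open Propagation φ Q stable germs

    from-bottom : ∀ {y v w} → Bottom φ v → Q v → Left φ y w → Q w
    from-bottom {y} (B , φ≡v) qv left with C , C≤B , C≤y ← under B y =
      propagate (<-≤-trans (x-1<x C) C≤y) (B , <-≤-trans (x-1<x C) C≤B , λ _ y<B → φ≡v y<B) qv left

    to-top : ∀ {x v w} → Right φ x v → Q v → Top φ w → Q w
    to-top {x} right qv (B , φ≡w) with C , B≤C , x≤C ← above B x =
      propagate (≤-<-trans x≤C (x<x+1 C)) right qv (B , ≤-<-trans B≤C (x<x+1 C) , λ B<y _ → φ≡w B<y)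

    across : ∀ {v w} → Bottom φ v → Q v → Top φ w → Q w
    across bot qv (B , φ≡w) =
      from-bottom bot qv (B , x<x+1 B , λ B<y _ → φ≡w B<y)

  module _ {D N₁ N₂ : Carrier → Carrier} {j₁ j₂ : ℤ} (I₁ : Index D N₁ j₁) (I₂ : Index D N₂ j₂) where

    TotalJump : Carrier → ℤ → Set
    TotalJump a i = ∃[ i₁ ] ∃[ i₂ ] Jump a D N₁ i₁ × Jump a D N₂ i₂ × i ≡ i₁ ℤ.+ i₂

    private
      φ₁₂ : Carrier → ℤ
      φ₁₂ x = φ I₁ x ℤ.+ φ I₂ x

      bottom₁₂ : Bottom φ₁₂ (lo I₁ ℤ.+ lo I₂)
      bottom₁₂ = Bottom-zip ℤ._+_ (bottom I₁) (bottom I₂)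

      top₁₂ : Top φ₁₂ (hi I₁ ℤ.+ hi I₂)
      top₁₂ = Top-zip ℤ._+_ (top I₁) (top I₂)

      interchange : ∀ l m i k → (l ℤ.+ i) ℤ.+ (m ℤ.+ k) ≡ (l ℤ.+ m) ℤ.+ (i ℤ.+ k)
      interchange = ℤ-solve 4 (λ l m i k → (l ⊕ i) ⊕ (m ⊕ k) ⊜ (l ⊕ m) ⊕ (i ⊕ k)) ≡.refl

      total₁₂ : hi I₁ ℤ.+ hi I₂ ≡ (lo I₁ ℤ.+ lo I₂) ℤ.+ (j₁ ℤ.+ j₂)
      total₁₂ = ≡.trans (≡.cong₂ ℤ._+_ (total I₁) (total I₂)) (interchange (lo I₁) (lo I₂) j₁ j₂)

      jump₁₂ : ∀ {a i} → TotalJump a i → ∃[ l ] Left φ₁₂ a l × Right φ₁₂ a (l ℤ.+ i)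
      jump₁₂ {a} (i₁ , i₂ , J₁ , J₂ , i≡)
        with l₁ , left₁ , right₁ ← jump I₁ J₁
        with l₂ , left₂ , right₂ ← jump I₂ J₂
        = l₁ ℤ.+ l₂ , Left-zip ℤ._+_ left₁ left₂ , ≡.subst (Right _ a)
            (≡.trans (interchange l₁ l₂ i₁ i₂) (≡.cong (ℤ._+_ (l₁ ℤ.+ l₂)) (≡.sym i≡)))
            (Right-zip ℤ._+_ right₁ right₂)

    index-constant : (∀ a → TotalJump a ℤ.0ℤ) → j₁ ℤ.+ j₂ ≡ ℤ.0ℤ
    index-constant jumps = ≡.trans
      (ℤ-solve 2 (λ l j → j ⊜ (l ⊕ j) ⊖ l) ≡.refl (lo I₁ ℤ.+ lo I₂) (j₁ ℤ.+ j₂))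
      (≡.trans (≡.cong (ℤ._- (lo I₁ ℤ.+ lo I₂)) (≡.trans (≡.sym total₁₂) hi≡lo)) (ℤ.+-inverseʳ (lo I₁ ℤ.+ lo I₂)))
      where
      germs : ∀ a → ∃[ v ] ∃[ w ] Left φ₁₂ a v × Right φ₁₂ a w × (v ≡ lo I₁ ℤ.+ lo I₂ → w ≡ lo I₁ ℤ.+ lo I₂)
      germs a with l , left , right ← jump₁₂ (jumps a)
        = l , l ℤ.+ ℤ.0ℤ , left , right , ≡.trans (ℤ.+-identityʳ l)
      hi≡lo : hi I₁ ℤ.+ hi I₂ ≡ lo I₁ ℤ.+ lo I₂
      hi≡lo = Sweep.across φ₁₂ (_≡ lo I₁ ℤ.+ lo I₂) (λ v → decidable-stable (v ℤ.≟ _)) germs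
        bottom₁₂ ≡.refl top₁₂

    -- The combined step function never falls: up to `b` it stays at or above its value near -∞, at
    -- `b` it rises strictly, and from then on it stays strictly above. So its two ends differ.
    index-increasing : (∀ a → ∃[ i ] TotalJump a i × ℤ.0ℤ ℤ.≤ i) →
      ∀ {b i} → TotalJump b i → ℤ.0ℤ ℤ.< i → ¬ (j₁ ℤ.+ j₂ ≡ ℤ.0ℤ)
    index-increasing jumps {b} {i} Jb 0<i j≡0 with l , left , right ← jump₁₂ Jb =
      ℤ.<-irrefl (≡.trans (≡.sym (ℤ.+-identityʳ _))
          (≡.trans (≡.cong (ℤ._+_ (lo I₁ ℤ.+ lo I₂)) (≡.sym j≡0)) (≡.sym total₁₂)))
        (Sweep.to-top φ₁₂ (_ ℤ.<_) (λ v → decidable-stable (_ ℤ.<? v))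
          (germs (_ ℤ.<_) (λ l i 0≤i lo<l → ℤ.<-≤-trans lo<l (up l i 0≤i)))
          right (ℤ.≤-<-trans lo≤l (≡.subst (ℤ._< l ℤ.+ i) (ℤ.+-identityʳ l) (ℤ.+-monoʳ-< l 0<i))) top₁₂)
      where
      up : ∀ l i → ℤ.0ℤ ℤ.≤ i → l ℤ.≤ l ℤ.+ i
      up l i 0≤i = ≡.subst (ℤ._≤ l ℤ.+ i) (ℤ.+-identityʳ l) (ℤ.+-monoʳ-≤ l 0≤i)
      germs : ∀ (Q : ℤ → Set) → (∀ l i → ℤ.0ℤ ℤ.≤ i → Q l → Q (l ℤ.+ i)) →
              ∀ a → ∃[ v ] ∃[ w ] Left φ₁₂ a v × Right φ₁₂ a w × (Q v → Q w)
      germs Q Q-up a with i , J , 0≤i ← jumps a with l , left , right ← jump₁₂ J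
        = l , l ℤ.+ i , left , right , Q-up l i 0≤i
      lo≤l : lo I₁ ℤ.+ lo I₂ ℤ.≤ l
      lo≤l = Sweep.from-bottom φ₁₂ (_ ℤ.≤_) (λ v → decidable-stable (_ ℤ.≤? v))
        (germs (_ ℤ.≤_) (λ l i 0≤i lo≤l → ℤ.≤-trans lo≤l (up l i 0≤i)))
        bottom₁₂ ℤ.≤-refl left

  square≈0 : ∀ {x} → x * x ≈ 0# → x ≈ 0#
  square≈0 {x} x²≈0 with <-cmp x 0#
  ... | tri< _ x≉0 _ = contradiction x²≈0 (≉0-* x≉0 x≉0)
  ... | tri≈ _ x≈0 _ = x≈0
  ... | tri> _ x≉0 _ = contradiction x²≈0 (≉0-* x≉0 x≉0)

  QueryJump : Carrier → (D W N : Carrier → Carrier) → Set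
  QueryJump a D W N = Jump a D N (sgn (W a) ℤ.+ sgn (W a))

  jump-nonRoot : ∀ {a} cs ns → ¬ (⟦ cs ⟧ a ≈ 0#) → Jump a ⟦ cs ⟧ ⟦ ns ⟧ ℤ.0ℤ
  jump-nonRoot cs ns ≉0 = regular 0 (lipschitz-⟦⟧ cs) ≉0 (lipschitz-⟦⟧ ns)
    (λ x → sym (*-identityˡ _)) (λ x → sym (*-identityˡ _))

  -- The cofactor `h` occurs once in the denominator and once more inside its derivative, and
  -- together they contribute h² > 0.
  sgn-cofactors : ∀ {h t w} → ¬ (h ≈ 0#) → 0# < t → sgn (h * (t * h * w)) ≡ sgn w
  sgn-cofactors {h} {t} {w} h≉0 0<t with <-cmp 0# (h * h)
  ... | tri> _ _ h²<0 = contradiction h²<0 (≤⇒≯ (square-nonNegative h))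
  ... | tri≈ _ 0≈h² _ = contradiction (sym 0≈h²) (≉0-* h≉0 h≉0)
  ... | tri< 0<h² _ _ = ≡.trans (sgn-cong (solve 3 (λ h t w → h :* (t :* h :* w) := h :* h :* t :* w) refl h t w))
    (≡.trans (sgn-* (h * h * t) w) (≡.trans (≡.cong (ℤ._* sgn w) (sgn-positive (*-positive 0<h² 0<t)))
      (ℤ.*-identityˡ (sgn w))))

  -- For D = (x - a)^(m+1) h the numerator is (x - a)^m u W with u a a positive multiple of h a, so
  -- there is a simple pole with the sign of W a. If W a = 0, the factor provided by the second
  -- hypothesis on `W` cancels that pole.
  jump-root : ∀ {a c W} cs {N} → ¬ (c ≈ 0#) → ⟦ c ∷ cs ⟧ a ≈ 0# → LipschitzAt W a →
    (W a ≈ 0# → ∃[ V ] LipschitzAt V a × (∀ x → W x ≈ (x - a) * V x)) →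
    (∀ x → N x ≈ ⟦ deriv (c ∷ cs) ⟧ x * W x) → QueryJump a ⟦ c ∷ cs ⟧ W N
  jump-root {a} {c} {W} cs {N} c≉0 ≈0 LW divide N≈ with factorise a cs c≉0
  ... | unit ≉0 = contradiction ≈0 ≉0
  ... | shift {ds = ds} cs≈ fac with deriv-root {cs = c ∷ cs} {ds} cs≈ fac | <-cmp (W a) 0#
  ...   | u , t , Lu , 0<t , ua≈ , D′≈ | cmp = go cmp
    where
    m = multiplicity fac
    h = ⟦ cofactor fac ⟧
    Lh : LipschitzAt h a
    Lh = lipschitz-⟦⟧ (cofactor fac)
    h≉0 = cofactor≉0 fac
    u≉0 : ¬ (u a ≈ 0#)
    u≉0 ua≈0 = ≉0-* (>⇒≉ 0<t) h≉0 (trans (sym ua≈) ua≈0)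
    D≈ : ∀ x → ⟦ c ∷ cs ⟧ x ≈ (x - a) ^ suc m * h x
    D≈ = factorisation-≈ (shift {cs = c ∷ cs} {ds} cs≈ fac)
    N≈′ : ∀ x → N x ≈ (x - a) ^ m * (u x * W x)
    N≈′ x = trans (N≈ x) (trans (*-congʳ (D′≈ x)) (*-assoc _ _ _))
    nonZero : ¬ (W a ≈ 0#) → QueryJump a ⟦ c ∷ cs ⟧ W N
    nonZero W≉0 = ≡.subst (Jump a ⟦ c ∷ cs ⟧ N) i≡ (pole 0 m Lh h≉0 (lipschitz-* Lu LW) (≉0-* u≉0 W≉0) D≈ N≈′)
      where
      σ≡ : sgn (h a * (u a * W a)) ≡ sgn (W a)
      σ≡ = ≡.trans (sgn-cong (*-congˡ (*-congʳ ua≈))) (sgn-cofactors h≉0 0<t)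
      i≡ : sgn (h a * (u a * W a)) ℤ.- flip (suc m ℕ.+ m) (sgn (h a * (u a * W a))) ≡ sgn (W a) ℤ.+ sgn (W a)
      -- The combined order 2m + 1 is odd, so the sign on the left is opposite to that on the right
      -- and their difference is a double.
      i≡ = ≡.cong₂ ℤ._+_ σ≡ (≡.trans (ℤ.neg-involutive _) (≡.trans (flip-even m _) σ≡))
    go : Tri (W a < 0#) (W a ≈ 0#) (0# < W a) → QueryJump a ⟦ c ∷ cs ⟧ W N
    go (tri< _ W≉0 _) = nonZero W≉0
    go (tri> _ W≉0 _) = nonZero W≉0
    go (tri≈ _ W≈0 _) with V , LV , W≈ ← divide W≈0 =
      ≡.subst (Jump a ⟦ c ∷ cs ⟧ N) (≡.sym (≡.cong₂ ℤ._+_ (sgn-zero W≈0) (sgn-zero W≈0)))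
        (regular (suc m) Lh h≉0 (lipschitz-* Lu LV) D≈ λ x → begin-equality
          N x                                   ≈⟨ N≈′ x ⟩
          (x - a) ^ m * (u x * W x)             ≈⟨ *-congˡ (*-congˡ (W≈ x)) ⟩
          (x - a) ^ m * (u x * ((x - a) * V x))
            ≈⟨ solve 4 (λ D u d v → D :* (u :* (d :* v)) := d :* D :* (u :* v)) refl
                                                     ((x - a) ^ m) (u x) (x - a) (V x) ⟩
          (x - a) * (x - a) ^ m * (u x * V x)   ∎)

  module Criterion {e c : Carrier} (es cs : List Carrier) (0<e : 0# < e) (c≉0 : ¬ (c ≈ 0#))
    (deriv≡ : deriv (e ∷ es) ≡ c ∷ cs) where

    private
      p f f′ : Carrier → Carrier
      p  = ⟦ e ∷ es ⟧
      f  = ⟦ c ∷ cs ⟧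
      f′ = ⟦ deriv (c ∷ cs) ⟧

      p≈ : ∀ {a} → p a ≈ 0# → ∀ x → p x ≈ (x - a) * ⟦ quotient a e es ⟧ x
      p≈ {a} p≈0 x = trans (quotient-remainder a e es x) (trans (+-congˡ p≈0) (+-identityʳ _))

      f-deriv : ∀ {a} (fac : Factorisation a (e ∷ es)) → p a ≈ 0# → ∃[ m ] ∃[ h ] ∃[ u ]
        LipschitzAt h a × LipschitzAt u a × ¬ (h a ≈ 0#) × ¬ (u a ≈ 0#) × sgn (u a) ≡ sgn (h a) ×
        (∀ x → p x ≈ (x - a) ^ suc m * h x) × (∀ x → f x ≈ (x - a) ^ m * u x)
      f-deriv (unit ≉0) ≈0 = contradiction ≈0 ≉0
      f-deriv {a} (shift {ds = ds} ps≈ fac) _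
        with u , t , Lu , 0<t , ua≈ , D′≈ ← deriv-root {cs = e ∷ es} {ds} ps≈ fac
        = multiplicity fac , ⟦ cofactor fac ⟧ , u , lipschitz-⟦⟧ (cofactor fac) , Lu , cofactor≉0 fac ,
          (λ ua≈0 → ≉0-* (>⇒≉ 0<t) (cofactor≉0 fac) (trans (sym ua≈) ua≈0)) ,
          ≡.trans (sgn-cong ua≈) (≡.trans (sgn-* t _) (≡.trans (≡.cong (ℤ._* _) (sgn-positive 0<t)) (ℤ.*-identityˡ _))) ,
          factorisation-≈ (shift {cs = e ∷ es} {ds} ps≈ fac) ,
          ≡.subst (λ qs → ∀ x → ⟦ qs ⟧ x ≈ _) deriv≡ D′≈

    BadRoot : Carrier → Set
    BadRoot a = f a ≈ 0# × p a < 0#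

    module _ (ns₁ ns₂ : List Carrier)
      (N₁≈ : ∀ x → ⟦ ns₁ ⟧ x ≈ f′ x * - p x) (N₂≈ : ∀ x → ⟦ ns₂ ⟧ x ≈ f′ x * (p x * p x))
      {j₁ j₂ : ℤ} (I₁ : Index f ⟦ ns₁ ⟧ j₁) (I₂ : Index f ⟦ ns₂ ⟧ j₂) where

      private
        at-root : ∀ a → f a ≈ 0# → TotalJump I₁ I₂ a
          ((sgn (- p a) ℤ.+ sgn (- p a)) ℤ.+ (sgn (p a * p a) ℤ.+ sgn (p a * p a)))
        at-root a f≈0 = _ , _ ,
          jump-root cs c≉0 f≈0 (lipschitz-neg (lipschitz-⟦⟧ (e ∷ es))) (λ -p≈0 →
            let p≈0 = trans (sym (-‿involutive (p a))) (trans (-‿cong -p≈0) -0#≈0#) in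
            (λ x → - ⟦ quotient a e es ⟧ x) , lipschitz-neg (lipschitz-⟦⟧ (quotient a e es)) ,
            λ x → trans (-‿cong (p≈ p≈0 x))
              (solve 2 (λ d q → :- (d :* q) := d :* :- q) refl (x - a) (⟦ quotient a e es ⟧ x))) N₁≈ ,
          jump-root cs c≉0 f≈0 (lipschitz-* (lipschitz-⟦⟧ (e ∷ es)) (lipschitz-⟦⟧ (e ∷ es))) (λ p²≈0 →
            (λ x → ⟦ quotient a e es ⟧ x * p x) ,
            lipschitz-* (lipschitz-⟦⟧ (quotient a e es)) (lipschitz-⟦⟧ (e ∷ es)) ,
            λ x → trans (*-congʳ (p≈ (square≈0 p²≈0) x)) (*-assoc _ _ _)) N₂≈ ,
          ≡.refl

        nonRoot : ∀ a → ¬ (f a ≈ 0#) → TotalJump I₁ I₂ a ℤ.0ℤ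
        nonRoot a f≉0 = _ , _ , jump-nonRoot (c ∷ cs) ns₁ f≉0 , jump-nonRoot (c ∷ cs) ns₂ f≉0 , ≡.refl

        -- Here -p and p² are both positive and contribute 2 each; where p > 0 their contributions
        -- -2 and 2 cancel.
        at-bad : ∀ a → BadRoot a → TotalJump I₁ I₂ a (+ 4)
        at-bad a (f≈0 , p<0) = ≡.subst (TotalJump I₁ I₂ a)
          (≡.cong₂ (λ s t → (s ℤ.+ s) ℤ.+ (t ℤ.+ t)) (sgn-positive (neg-positive p<0)) (sgn-positive (*-negative p<0 p<0)))
          (at-root a f≈0)

        at-good : ∀ a → 0# ≤ p a → TotalJump I₁ I₂ a ℤ.0ℤ
        at-good a 0≤p with <-cmp (f a) 0#
        ... | tri< _ f≉0 _ = nonRoot a f≉0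
        ... | tri> _ f≉0 _ = nonRoot a f≉0
        at-good a (inj₁ 0<p) | tri≈ _ f≈0 _ = ≡.subst (TotalJump I₁ I₂ a)
          (≡.cong₂ (λ s t → (s ℤ.+ s) ℤ.+ (t ℤ.+ t)) (sgn-negative (neg-negative 0<p)) (sgn-positive (*-positive 0<p 0<p)))
          (at-root a f≈0)
        at-good a (inj₂ 0≈p) | tri≈ _ f≈0 _ = ≡.subst (TotalJump I₁ I₂ a)
          (≡.cong₂ (λ s t → (s ℤ.+ s) ℤ.+ (t ℤ.+ t)) (sgn-zero (trans (-‿cong (sym 0≈p)) -0#≈0#))
            (sgn-zero (trans (*-congʳ (sym 0≈p)) (zeroˡ _))))
          (at-root a f≈0)

        total-jump : ∀ a → ∃[ i ] TotalJump I₁ I₂ a i × ℤ.0ℤ ℤ.≤ i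
        total-jump a with <-cmp (f a) 0# | <-cmp (p a) 0#
        ... | tri< _ f≉0 _ | _ = _ , nonRoot a f≉0 , ℤ.≤-refl
        ... | tri> _ f≉0 _ | _ = _ , nonRoot a f≉0 , ℤ.≤-refl
        ... | tri≈ _ f≈0 _ | tri< p<0 _ _ = _ , at-bad a (f≈0 , p<0) , ℤ.+≤+ ℕ.z≤n
        ... | tri≈ _ f≈0 _ | tri≈ _ p≈0 _ = _ , at-good a (inj₂ (sym p≈0)) , ℤ.≤-refl
        ... | tri≈ _ f≈0 _ | tri> _ _ 0<p = _ , at-good a (inj₁ 0<p) , ℤ.≤-refl

      nonNegative⇒index≡0 : (∀ x → 0# ≤ p x) → j₁ ℤ.+ j₂ ≡ ℤ.0ℤ
      nonNegative⇒index≡0 0≤p = index-constant I₁ I₂ (λ a → at-good a (0≤p a))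

      index≡0⇒¬badRoot : j₁ ℤ.+ j₂ ≡ ℤ.0ℤ → ∀ a → ¬ BadRoot a
      index≡0⇒¬badRoot j≡0 a bad =
        index-increasing I₁ I₂ total-jump (at-bad a bad) (ℤ.+<+ (ℕ.s≤s ℕ.z≤n)) j≡0

    private
      signs : Carrier → ℤ × ℤ
      signs x = sgn (p x) , sgn (f x)

      signs-left : ∀ {a v w} → Left (sgn ∘ p) a v → Left (sgn ∘ f) a w → Left signs a (v , w)
      signs-left = Left-zip _,_

      signs-right : ∀ {a v w} → Right (sgn ∘ p) a v → Right (sgn ∘ f) a w → Right signs a (v , w)
      signs-right = Right-zip _,_

      -- Where p < 0, the derivative f has no root, so a falling p stays negative
      -- up to +∞ and a rising p has been negative since -∞.
      Falling ¬Rising : ℤ × ℤ → Set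
      Falling v = v ≡ (ℤ.-1ℤ , ℤ.-1ℤ)
      ¬Rising v = ¬ (v ≡ (ℤ.-1ℤ , ℤ.1ℤ))

      module _ {F : Carrier → Carrier} {a : Carrier} (LF : LipschitzAt F a) (F≉0 : ¬ (F a ≈ 0#)) where

        constant-left : Left (sgn ∘ F) a (sgn (F a))
        constant-left = sgn-left 0 (λ x → sym (*-identityˡ (F x))) LF F≉0

        constant-right : Right (sgn ∘ F) a (sgn (F a))
        constant-right = sgn-right 0 (λ x → sym (*-identityˡ (F x))) LF F≉0

      Persist : Carrier → Set
      Persist a = ∃[ v ] ∃[ w ] Left signs a v × Right signs a w × (Falling v → Falling w) × (¬Rising v → ¬Rising w)

      x≡-1∧-x≡-1 : ∀ {i} → ℤ.- i ≡ ℤ.-1ℤ → i ≡ ℤ.-1ℤ → ⊥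
      x≡-1∧-x≡-1 () ≡.refl

      -- The orders of p and f at a root of p differ by one and their cofactors agree in sign. So p
      -- and f have opposite signs on the left, which excludes falling below 0, and equal signs on
      -- the right, which excludes rising below 0.
      persist-root : ∀ a → p a ≈ 0# → Persist a
      persist-root a p≈0
        with m , h , u , Lh , Lu , h≉0 , u≉0 , σ≡ , p≈ , f≈ ← f-deriv (factorise a es (>⇒≉ 0<e)) p≈0
        = (flip (suc m) (sgn (h a)) , flip m (sgn (u a))) , (sgn (h a) , sgn (u a)) ,
          signs-left (sgn-left (suc m) p≈ Lh h≉0) (sgn-left m f≈ Lu u≉0) ,
          signs-right (sgn-right (suc m) p≈ Lh h≉0) (sgn-right m f≈ Lu u≉0) ,
          (λ eq → contradiction (≡.trans (≡.cong (flip m) (≡.sym σ≡)) (≡.cong proj₂ eq))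
            (x≡-1∧-x≡-1 (≡.cong proj₁ eq))) ,
          (λ _ eq → case ≡.trans (≡.sym (≡.cong proj₁ eq)) (≡.trans (≡.sym σ≡) (≡.cong proj₂ eq)) of λ ())

      persist-constant : ∀ {a} → ¬ (p a ≈ 0#) → ¬ (f a ≈ 0#) → Persist a
      persist-constant p≉0 f≉0 = _ , _ ,
        signs-left (constant-left (lipschitz-⟦⟧ (e ∷ es)) p≉0) (constant-left (lipschitz-⟦⟧ (c ∷ cs)) f≉0) ,
        signs-right (constant-right (lipschitz-⟦⟧ (e ∷ es)) p≉0) (constant-right (lipschitz-⟦⟧ (c ∷ cs)) f≉0) , id , id

      persist-positive : ∀ {a} → 0# < p a → Persist a
      persist-positive {a} 0<p = _ , _ ,
        signs-left (constant-left (lipschitz-⟦⟧ (e ∷ es)) (>⇒≉ 0<p)) (sgn-left m f≈ Lu u≉0) ,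
        signs-right (constant-right (lipschitz-⟦⟧ (e ∷ es)) (>⇒≉ 0<p)) (sgn-right m f≈ Lu u≉0) ,
        (λ eq → contradiction (≡.cong proj₁ eq) p≢-1) , λ _ eq → contradiction (≡.cong proj₁ eq) p≢-1
        where
        fac = factorise a cs c≉0
        m = multiplicity fac
        f≈ = factorisation-≈ fac
        u≉0 = cofactor≉0 fac
        Lu : LipschitzAt ⟦ cofactor fac ⟧ a
        Lu = lipschitz-⟦⟧ (cofactor fac)
        p≢-1 : ¬ (sgn (p a) ≡ ℤ.-1ℤ)
        p≢-1 rewrite sgn-positive 0<p = λ ()

    ¬badRoot⇒nonNegative : flip (length es) ℤ.1ℤ ≡ ℤ.1ℤ → (∀ a → ¬ BadRoot a) → ∀ x → 0# ≤ p x
    ¬badRoot⇒nonNegative even ¬bad x = ≮⇒≥ impossible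
      where
      persist : ∀ a → Persist a
      persist a with <-cmp (p a) 0#
      ... | tri< p<0 p≉0 _ = persist-constant p≉0 (λ f≈0 → ¬bad a (f≈0 , p<0))
      ... | tri≈ _ p≈0 _   = persist-root a p≈0
      ... | tri> _ _ 0<p   = persist-positive 0<p
      module Fall = Sweep signs Falling (λ v → decidable-stable (≡-dec ℤ._≟_ ℤ._≟_ v _))
        (λ a → case persist a of λ (v , w , left , right , falling , _) → v , w , left , right , falling)
      -- Propagation runs only to the right, so the statement about the past is used in
      -- contrapositive form: `¬Rising` starts near -∞, where even degree makes p positive.
      module Rise = Sweep signs ¬Rising (λ v → negated-stable)
        (λ a → case persist a of λ (v , w , left , right , _ , ¬rising) → v , w , left , right , ¬rising)
      top-1 : ∃[ w ] Top signs (ℤ.1ℤ , w)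
      top-1 = _ , ≡.subst (λ s → Top signs (s , _)) (sgn-positive 0<e)
        (Top-zip _,_ (sgn-top es (>⇒≉ 0<e)) (sgn-top cs c≉0))
      bottom-1 : ∃[ w ] Bottom signs (ℤ.1ℤ , w)
      bottom-1 = _ , ≡.subst (λ s → Bottom signs (s , _)) (≡.trans (≡.cong (flip (length es)) (sgn-positive 0<e)) even)
        (Bottom-zip _,_ (sgn-bottom es (>⇒≉ 0<e)) (sgn-bottom cs c≉0))
      impossible : ¬ (p x < 0#)
      impossible px<0 with <-cmp (f x) 0#
      ... | tri≈ _ f≈0 _ = ¬bad x (f≈0 , px<0)
      ... | tri< fx<0 f≉0 _ = case Fall.to-top
        (signs-right (constant-right (lipschitz-⟦⟧ (e ∷ es)) (<⇒≉ px<0)) (constant-right (lipschitz-⟦⟧ (c ∷ cs)) f≉0))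
        (≡.cong₂ _,_ (sgn-negative px<0) (sgn-negative fx<0)) (proj₂ top-1) of λ ()
      ... | tri> _ f≉0 0<fx = Rise.from-bottom (proj₂ bottom-1) (λ ())
        (signs-left (constant-left (lipschitz-⟦⟧ (e ∷ es)) (<⇒≉ px<0)) (constant-left (lipschitz-⟦⟧ (c ∷ cs)) f≉0))
        (≡.cong₂ _,_ (sgn-negative px<0) (sgn-positive 0<fx))

  odd⇒¬nonNegative : ∀ {e} es → 0# < e → flip (length es) ℤ.1ℤ ≡ ℤ.-1ℤ → ¬ (∀ x → 0# ≤ ⟦ e ∷ es ⟧ x)
  odd⇒¬nonNegative {e} es 0<e odd 0≤p with B , sgn≡ ← sgn-bottom es (>⇒≉ 0<e) = at (0≤p (B - 1#))
    where
    s≡-1 : sgn (⟦ e ∷ es ⟧ (B - 1#)) ≡ ℤ.-1ℤ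
    s≡-1 = ≡.trans (sgn≡ (x-1<x B)) (≡.trans (≡.cong (flip (length es)) (sgn-positive 0<e)) odd)
    at : ¬ (0# ≤ ⟦ e ∷ es ⟧ (B - 1#))
    at (inj₁ 0<p) = case ≡.trans (≡.sym (sgn-positive 0<p)) s≡-1 of λ ()
    at (inj₂ 0≈p) = case ≡.trans (≡.sym (sgn-zero (sym 0≈p))) s≡-1 of λ ()

-- Register programs and the Euclidean procedure

-- Programs name registers by level, counted from the oldest register, so that a
-- name stays valid when further registers are added.

data Ref : Set where
  level    : ℕ → Ref
  zero one : Ref

data Program (A : Set) : Set where
  return : A → Program A
  arith  : ArithOp → Ref → Ref → (Ref → Program A) → Program A
  branch : Ref → Ref → (less equal greater : Program A) → Program A

infixl 1 _>>=_
-- Integers and lists of references are results known at each leaf while the tree is built, so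
-- handling them costs no operation. The continuation is copied into all three branches of a
-- comparison; the tree grows, but cost is counted along one path.
_>>=_ : ∀ {A B} → Program A → (A → Program B) → Program B
return a       >>= f = f a
arith o u v k  >>= f = arith o u v λ r → k r >>= f
branch u v l e g >>= f = branch u v (l >>= f) (e >>= f) (g >>= f)

weaken : ∀ {n} → Operand n → Operand (suc n)
weaken (reg i) = reg (suc i)
weaken zero    = zero
weaken one     = one

register : ∀ n → ℕ → Operand n
-- A default for levels that no register bears; `Holds` excludes them wherever a value is read.
register zero    ℓ = zero
register (suc n) ℓ with n ℕ.≟ ℓ
... | yes _ = reg zero
... | no  _ = weaken (register n ℓ)

operand : ∀ n → Ref → Operand n
operand n (level ℓ) = register n ℓ
operand n zero      = zero
operand n one       = one

compile : ∀ n → Program Bool → Tree n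
compile n (return b)       = answer b
compile n (arith o u v k)  = compute o (operand n u) (operand n v) (compile (suc n) (k (level n)))
compile n (branch u v l e g) =
  compare (operand n u) (operand n v) (compile n l) (compile n e) (compile n g)

-- Coefficients are matched from the leading end.
subScaled : List Ref → Ref → List Ref → Program (List Ref)
subScaled xs       c []       = return xs
subScaled []       c (y ∷ ys) = return []
subScaled (x ∷ xs) c (y ∷ ys) =
  arith mul c y λ t → arith sub x t λ z → subScaled xs c ys >>= λ zs → return (z ∷ zs)

-- Schoolbook multiplication by repeated `subScaled`, which can only subtract; hence the sign.
-- Applied once to f′ and p it gives - f′ p, applied again f′ p², which are the two numerators
-- wanted. A spare leading zero makes the lengths add.
negProduct : List Ref → List Ref → Program (List Ref)
negProduct []       ys = return (map (λ _ → zero) ys)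
negProduct (x ∷ xs) ys =
  negProduct xs ys >>= λ zs → subScaled zs x ys >>= λ ws → return (zero ∷ ws)

-- The second component is the degree.
derivative : List Ref → Program (List Ref × Ref)
derivative []           = return ([] , zero)
derivative (c ∷ [])     = return ([] , zero)
derivative (c ∷ b ∷ bs) = derivative (b ∷ bs) >>= λ (ds , k) →
  arith add k one λ k′ → arith mul k′ c λ t → return (t ∷ ds , k′)

-- The first argument is fuel; σ is the sign of the leading coefficient d of the
-- denominator.
cauchyIndex : ℕ → ℤ → Ref → List Ref → List Ref → Program ℤ
cauchyIndexStep : ℕ → ℤ → ℤ → (d : Ref) (ds : List Ref) (n : Ref) (ns : List Ref) →
                  Dec (length ds ℕ.≤ length ns) → Program ℤ

cauchyIndex k       σ d ds []       = return ℤ.0ℤ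
cauchyIndex zero    σ d ds (n ∷ ns) = return ℤ.0ℤ
cauchyIndex (suc k) σ d ds (n ∷ ns) = branch n zero
  (cauchyIndexStep k σ ℤ.-1ℤ d ds n ns (length ds ℕ.≤? length ns))
  (cauchyIndex k σ d ds ns)
  (cauchyIndexStep k σ ℤ.1ℤ d ds n ns (length ds ℕ.≤? length ns))

cauchyIndexStep k σ τ d ds n ns (yes _) =
  arith div n d λ c → subScaled ns c ds >>= cauchyIndex k σ d ds
cauchyIndexStep k σ τ d ds n ns (no _)  =
  arith div d n λ c → subScaled ds c ns >>= λ ds′ → cauchyIndex k τ n ns ds′ >>= λ j →
  return ((σ ℤ.* τ ℤ.- flip (length ds ℕ.+ length ns) (σ ℤ.* τ)) ℤ.- j)

-- Each eliminated coefficient costs one sign test, one division, and a multiplication and a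
-- subtraction for each of at most `k` entries of the subtracted list.
cauchyIndexCost : ℕ → ℕ
cauchyIndexCost zero    = 0
cauchyIndexCost (suc k) = suc (suc (2 ℕ.* k ℕ.+ cauchyIndexCost k))

-- Correctness and cost of the program pieces

module Execution (R : CompleteOrderedField) where

  open CompleteOrderedField R hiding (zero)
  open OrderedFieldProperties R
  open Germs R
  open Polynomials R
  open CauchyIndex R
  open Semantics R
  open Algebra.Properties.Semiring.Exp semiring using (^-homo-*)
  open ≤-Reasoning

  data Holds : ∀ {n} → Vec Carrier n → Ref → Carrier → Set where
    here  : ∀ {n x} {ρ : Vec Carrier n} → Holds (x ∷ ρ) (level n) x
    there : ∀ {n ℓ x y} {ρ : Vec Carrier n} → Holds ρ (level ℓ) x → Holds (y ∷ ρ) (level ℓ) x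
    zero  : ∀ {n} {ρ : Vec Carrier n} → Holds ρ zero 0#
    one   : ∀ {n} {ρ : Vec Carrier n} → Holds ρ one 1#

  Holds* : ∀ {n} → Vec Carrier n → List Ref → List Carrier → Set
  Holds* ρ = Pointwise (Holds ρ)

  infix 4 _⊑_
  _⊑_ : ∀ {m n} → Vec Carrier m → Vec Carrier n → Set
  ρ ⊑ ρ′ = ∀ {u x} → Holds ρ u x → Holds ρ′ u x

  ⊑-∷ : ∀ {n} {ρ : Vec Carrier n} {x} → ρ ⊑ (x ∷ ρ)
  ⊑-∷ here      = there here
  ⊑-∷ (there h) = there (there h)
  ⊑-∷ zero      = zero
  ⊑-∷ one       = one

  level-< : ∀ {n ℓ x} {ρ : Vec Carrier n} → Holds ρ (level ℓ) x → ℓ ℕ.< n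
  level-< here      = ℕ.n<1+n _
  level-< (there h) = ℕ.m<n⇒m<1+n (level-< h)

  value-weaken : ∀ {n} {ρ : Vec Carrier n} {x} (u : Operand n) → value (x ∷ ρ) (weaken u) ≡ value ρ u
  value-weaken (reg i) = ≡.refl
  value-weaken zero    = ≡.refl
  value-weaken one     = ≡.refl

  value-operand : ∀ {n u x} {ρ : Vec Carrier n} → Holds ρ u x → value ρ (operand n u) ≡ x
  value-operand zero = ≡.refl
  value-operand one  = ≡.refl
  value-operand {suc n} here with n ℕ.≟ n
  ... | yes _   = ≡.refl
  ... | no  n≢n = contradiction ≡.refl n≢n
  value-operand {suc n} {level ℓ} (there h) with n ℕ.≟ ℓ
  ... | yes n≡ℓ = contradiction (≡.sym n≡ℓ) (ℕ.<⇒≢ (level-< h))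
  ... | no  _   = ≡.trans (value-weaken (register n ℓ)) (value-operand h)

  -- Run on registers ρ, the program halts in a state satisfying Q after at most
  -- c operations, where c is the last index.
  data WP {A : Set} (Q : ∀ {m} → Vec Carrier m → A → Set) :
          ∀ {n} → Vec Carrier n → Program A → ℕ → Set where
    return  : ∀ {n} {ρ : Vec Carrier n} {a c} → Q ρ a → WP Q ρ (return a) c
    arith   : ∀ {n} {ρ : Vec Carrier n} {o u v x y k c} z → Holds ρ u x → Holds ρ v y →
              Computes o x y z → WP Q (z ∷ ρ) (k (level n)) c → WP Q ρ (arith o u v k) (suc c)
    less    : ∀ {n} {ρ : Vec Carrier n} {u v x y l e g c} → Holds ρ u x → Holds ρ v y →
              x < y → WP Q ρ l c → WP Q ρ (branch u v l e g) (suc c)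
    equal   : ∀ {n} {ρ : Vec Carrier n} {u v x y l e g c} → Holds ρ u x → Holds ρ v y →
              x ≈ y → WP Q ρ e c → WP Q ρ (branch u v l e g) (suc c)
    greater : ∀ {n} {ρ : Vec Carrier n} {u v x y l e g c} → Holds ρ u x → Holds ρ v y →
              y < x → WP Q ρ g c → WP Q ρ (branch u v l e g) (suc c)

  relax : ∀ {A : Set} {Q : ∀ {m} → Vec Carrier m → A → Set} {n c c′} {ρ : Vec Carrier n} {p : Program A} →
          c ℕ.≤ c′ → WP Q ρ p c → WP Q ρ p c′
  relax c≤c′       (return q)          = return q
  relax (s≤s c≤c′) (arith z hu hv r w) = arith z hu hv r (relax c≤c′ w)
  relax (s≤s c≤c′) (less hu hv r w)    = less hu hv r (relax c≤c′ w)
  relax (s≤s c≤c′) (equal hu hv r w)   = equal hu hv r (relax c≤c′ w)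
  relax (s≤s c≤c′) (greater hu hv r w) = greater hu hv r (relax c≤c′ w)

  mono : ∀ {A : Set} {Q Q′ : ∀ {m} → Vec Carrier m → A → Set} {n c} {ρ : Vec Carrier n} {p : Program A} →
         (∀ {m} {ρ : Vec Carrier m} {a} → Q ρ a → Q′ ρ a) → WP Q ρ p c → WP Q′ ρ p c
  mono Q⇒Q′ (return q)          = return (Q⇒Q′ q)
  mono Q⇒Q′ (arith z hu hv r w) = arith z hu hv r (mono Q⇒Q′ w)
  mono Q⇒Q′ (less hu hv r w)    = less hu hv r (mono Q⇒Q′ w)
  mono Q⇒Q′ (equal hu hv r w)   = equal hu hv r (mono Q⇒Q′ w)
  mono Q⇒Q′ (greater hu hv r w) = greater hu hv r (mono Q⇒Q′ w)

  -- References obtained earlier stay valid in the continuation because levels are never reused, and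
  -- the costs of the two pieces add along a path.
  bind : ∀ {A B : Set} {Q : ∀ {m} → Vec Carrier m → A → Set} {Q′ : ∀ {m} → Vec Carrier m → B → Set}
         {n c c′} {ρ : Vec Carrier n} {p : Program A} {f : A → Program B} → WP Q ρ p c →
         (∀ {m} {ρ′ : Vec Carrier m} {a} → ρ ⊑ ρ′ → Q ρ′ a → WP Q′ ρ′ (f a) c′) →
         WP Q′ ρ (p >>= f) (c ℕ.+ c′)
  bind {c = c} {c′} (return q) k = relax (ℕ.m≤n+m c′ c) (k id q)
  bind (arith z hu hv r w) k = arith z hu hv r (bind w λ ρ⊑ → k (ρ⊑ ∘ ⊑-∷))
  bind (less hu hv r w)    k = less hu hv r (bind w k)
  bind (equal hu hv r w)   k = equal hu hv r (bind w k)
  bind (greater hu hv r w) k = greater hu hv r (bind w k)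

  compile-correct : ∀ {Q : Bool → Set} {n c} {ρ : Vec Carrier n} {p} → WP (λ _ → Q) ρ p c →
                    ∃[ b ] ∃[ k ] (ρ ⊢ compile n p ⇓ b after k) × Q b × k ℕ.≤ c
  compile-correct (return q) = _ , 0 , answer , q , z≤n
  compile-correct (arith {o = o} z hu hv r w) with b , k , run , q , k≤c ← compile-correct w
    = b , suc k , compute z (≡.subst₂ (λ x y → Computes o x y z)
        (≡.sym (value-operand hu)) (≡.sym (value-operand hv)) r) run , q , s≤s k≤c
  compile-correct (less hu hv r w) with b , k , run , q , k≤c ← compile-correct w
    = b , suc k , less (≡.subst₂ _<_ (≡.sym (value-operand hu)) (≡.sym (value-operand hv)) r) run , q , s≤s k≤c
  compile-correct (equal hu hv r w) with b , k , run , q , k≤c ← compile-correct w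
    = b , suc k , equal (≡.subst₂ _≈_ (≡.sym (value-operand hu)) (≡.sym (value-operand hv)) r) run , q , s≤s k≤c
  compile-correct (greater hu hv r w) with b , k , run , q , k≤c ← compile-correct w
    = b , suc k , greater (≡.subst₂ _<_ (≡.sym (value-operand hv)) (≡.sym (value-operand hu)) r) run , q , s≤s k≤c

  subMul : List Carrier → Carrier → List Carrier → List Carrier
  subMul xs       c []       = xs
  subMul []       c (y ∷ ys) = []
  subMul (x ∷ xs) c (y ∷ ys) = (x - c * y) ∷ subMul xs c ys

  negMul : List Carrier → List Carrier → List Carrier
  negMul []       ys = map (λ _ → 0#) ys
  negMul (x ∷ xs) ys = 0# ∷ subMul (negMul xs ys) x ys

  length-subMul : ∀ xs c ys → length (subMul xs c ys) ≡ length xs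
  length-subMul xs       c []       = ≡.refl
  length-subMul []       c (y ∷ ys) = ≡.refl
  length-subMul (x ∷ xs) c (y ∷ ys) = ≡.cong suc (length-subMul xs c ys)

  length-negMul : ∀ xs ys → length (negMul xs ys) ≡ length xs ℕ.+ length ys
  length-negMul []       ys = List.length-map _ ys
  length-negMul (x ∷ xs) ys = ≡.cong suc (≡.trans (length-subMul (negMul xs ys) x ys) (length-negMul xs ys))

  -- Alignment at the leading ends raises the degree of `ys` by the difference `k` of the lengths.
  ⟦⟧-subMul : ∀ k c {xs ys} → length xs ≡ k ℕ.+ length ys → ∀ x →
              ⟦ subMul xs c ys ⟧ x ≈ ⟦ xs ⟧ x - c * x ^ k * ⟦ ys ⟧ x
  ⟦⟧-subMul k c {xs} {[]} len x =
    solve 3 (λ X c K → X := X :- c :* K :* con (+ 0)) refl (⟦ xs ⟧ x) c (x ^ k)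
  ⟦⟧-subMul k c {[]} {y ∷ ys} len x = contradiction (≡.trans len (ℕ.+-suc k (length ys))) λ ()
  ⟦⟧-subMul k c {x₀ ∷ xs} {y ∷ ys} len x = begin-equality
    (x₀ - c * y) * x ^ length (subMul xs c ys) + ⟦ subMul xs c ys ⟧ x
      ≈⟨ +-cong (*-congˡ (reflexive (≡.cong (x ^_) (≡.trans (length-subMul xs c ys) len′)))) (⟦⟧-subMul k c {xs} {ys} len′ x) ⟩
    (x₀ - c * y) * x ^ (k ℕ.+ length ys) + (⟦ xs ⟧ x - c * x ^ k * ⟦ ys ⟧ x)
      ≈⟨ solve 7 (λ a c y K X Y E → (a :- c :* y) :* E :+ (X :- c :* K :* Y) :=
           a :* E :+ X :- (c :* y :* E :+ c :* K :* Y)) refl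
           x₀ c y (x ^ k) (⟦ xs ⟧ x) (⟦ ys ⟧ x) (x ^ (k ℕ.+ length ys)) ⟩
    x₀ * x ^ (k ℕ.+ length ys) + ⟦ xs ⟧ x - (c * y * x ^ (k ℕ.+ length ys) + c * x ^ k * ⟦ ys ⟧ x)
      ≈⟨ +-cong (+-congʳ (*-congˡ (reflexive (≡.cong (x ^_) (≡.sym len′)))))
           (-‿cong (trans (+-congʳ (*-congˡ (^-homo-* x k (length ys))))
             (solve 5 (λ c y K L Y → c :* y :* (K :* L) :+ c :* K :* Y := c :* K :* (y :* L :+ Y)) refl
               c y (x ^ k) (x ^ length ys) (⟦ ys ⟧ x)))) ⟩
    x₀ * x ^ length xs + ⟦ xs ⟧ x - c * x ^ k * (y * x ^ length ys + ⟦ ys ⟧ x) ∎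
    where
    len′ : length xs ≡ k ℕ.+ length ys
    len′ = ℕ.suc-injective (≡.trans len (ℕ.+-suc k (length ys)))

  ⟦⟧-zeros : ∀ (ys : List Carrier) x → ⟦ map (λ _ → 0#) ys ⟧ x ≈ 0#
  ⟦⟧-zeros []       x = refl
  ⟦⟧-zeros (y ∷ ys) x = trans (+-cong (zeroˡ _) (⟦⟧-zeros ys x)) (+-identityʳ 0#)

  ⟦⟧-negMul : ∀ xs ys x → ⟦ negMul xs ys ⟧ x ≈ - (⟦ xs ⟧ x * ⟦ ys ⟧ x)
  ⟦⟧-negMul [] ys x = trans (⟦⟧-zeros ys x) (solve 1 (λ y → con (+ 0) := :- (con (+ 0) :* y)) refl (⟦ ys ⟧ x))
  ⟦⟧-negMul (c ∷ xs) ys x = begin-equality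
    0# * Z + ⟦ subMul (negMul xs ys) c ys ⟧ x
      ≈⟨ +-congˡ (⟦⟧-subMul (length xs) c {negMul xs ys} {ys} (length-negMul xs ys) x) ⟩
    0# * Z + (⟦ negMul xs ys ⟧ x - c * x ^ length xs * ⟦ ys ⟧ x) ≈⟨ +-congˡ (+-congʳ (⟦⟧-negMul xs ys x)) ⟩
    0# * Z + (- (⟦ xs ⟧ x * ⟦ ys ⟧ x) - c * x ^ length xs * ⟦ ys ⟧ x)
                                                               ≈⟨ solve 5 (λ Z X Y c E → con (+ 0) :* Z :+ (:- (X :* Y) :- c :* E :* Y) :=
                                                                    :- ((c :* E :+ X) :* Y)) refl Z (⟦ xs ⟧ x) (⟦ ys ⟧ x) c (x ^ length xs) ⟩
    - ((c * x ^ length xs + ⟦ xs ⟧ x) * ⟦ ys ⟧ x)              ∎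
    where
    Z : Carrier
    Z = x ^ length (subMul (negMul xs ys) c ys)

  extend : ∀ {m n us xs} {ρ : Vec Carrier m} {ρ′ : Vec Carrier n} → ρ ⊑ ρ′ → Holds* ρ us xs → Holds* ρ′ us xs
  extend ρ⊑ρ′ = Pointwise.map ρ⊑ρ′

  subScaled-correct : ∀ {n us u vs xs c ys} {ρ : Vec Carrier n} →
    Holds* ρ us xs → Holds ρ u c → Holds* ρ vs ys →
    WP (λ ρ′ zs → Holds* ρ′ zs (subMul xs c ys)) ρ (subScaled us u vs) (2 ℕ.* length ys)
  subScaled-correct hxs hc [] = return hxs
  subScaled-correct [] hc (hy ∷ hys) = return []
  subScaled-correct {ys = y ∷ ys} (hx ∷ hxs) hc (hy ∷ hys)
    rewrite ℕ.+-suc (length ys) (length ys ℕ.+ 0) =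
    arith _ hc hy refl (arith _ (⊑-∷ hx) here refl
      (relax (ℕ.≤-reflexive (ℕ.+-identityʳ _))
        (bind {c′ = 0} (subScaled-correct (extend (⊑-∷ ∘ ⊑-∷) hxs) (⊑-∷ (⊑-∷ hc)) (extend (⊑-∷ ∘ ⊑-∷) hys))
          λ ρ⊑ hzs → return (ρ⊑ here ∷ hzs))))

  negProduct-correct : ∀ {n us vs xs ys} {ρ : Vec Carrier n} → Holds* ρ us xs → Holds* ρ vs ys →
    WP (λ ρ′ zs → Holds* ρ′ zs (negMul xs ys)) ρ (negProduct us vs) (length xs ℕ.* (2 ℕ.* length ys))
  negProduct-correct [] hys = return (Pointwise.map⁺ _ _ (Pointwise.map (λ _ → zero) hys))
  negProduct-correct {xs = x ∷ xs} {ys} (hx ∷ hxs) hys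
    rewrite ℕ.+-comm (2 ℕ.* length ys) (length xs ℕ.* (2 ℕ.* length ys)) =
    bind (negProduct-correct hxs hys) λ ρ⊑ hzs →
    relax (ℕ.≤-reflexive (ℕ.+-identityʳ _))
      (bind {c′ = 0} (subScaled-correct hzs (ρ⊑ hx) (extend ρ⊑ hys)) λ _ hws → return (zero ∷ hws))

  derivative-correct : ∀ {n u us c cs} {ρ : Vec Carrier n} → Holds* ρ (u ∷ us) (c ∷ cs) →
    WP (λ ρ′ (ds , k) → Holds* ρ′ ds (deriv (c ∷ cs)) × Holds ρ′ k (fromℕ (length cs))) ρ
       (derivative (u ∷ us)) (2 ℕ.* length cs)
  derivative-correct (h ∷ []) = return ([] , zero)
  derivative-correct {cs = b ∷ bs} (h ∷ hb ∷ hbs) =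
    relax (ℕ.≤-reflexive (≡.trans (ℕ.+-comm _ 2) (≡.cong suc (≡.sym (ℕ.+-suc (length bs) _)))))
      (bind {c′ = 2} (derivative-correct (hb ∷ hbs)) λ ρ⊑ (hds , hk) →
        arith _ hk one refl (arith _ here (⊑-∷ (ρ⊑ h)) refl
          (return ((here ∷ extend (⊑-∷ ∘ ⊑-∷) hds) , ⊑-∷ here))))

  -- One step of long division: `c` is chosen to cancel the leading terms, so the heads are dropped
  -- unevaluated and only the tails are combined.
  reduction-≈ : ∀ {n d c} ns ds → c * d ≈ n → length ds ℕ.≤ length ns → ∀ x →
    ⟦ n ∷ ns ⟧ x ≈ ⟦ subMul ns c ds ⟧ x + c * x ^ (length ns ℕ.∸ length ds) * ⟦ d ∷ ds ⟧ x
  reduction-≈ {n} {d} {c} ns ds cd≈n ds≤ns x = begin-equality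
    n * x ^ length ns + N                ≈⟨ +-congʳ (*-congʳ cd≈n) ⟨
    c * d * x ^ length ns + N
      ≈⟨ +-congʳ (*-congˡ (trans (reflexive (≡.cong (x ^_) len)) (^-homo-* x k (length ds)))) ⟩
    c * d * (x ^ k * x ^ length ds) + N  ≈⟨ solve 6 (λ c d K E N D → c :* d :* (K :* E) :+ N :=
                                              N :- c :* K :* D :+ c :* K :* (d :* E :+ D)) refl
                                              c d (x ^ k) (x ^ length ds) N (⟦ ds ⟧ x) ⟩
    N - c * x ^ k * ⟦ ds ⟧ x + c * x ^ k * ⟦ d ∷ ds ⟧ x
                                         ≈⟨ +-congʳ (⟦⟧-subMul k c {ns} {ds} len x) ⟨
    ⟦ subMul ns c ds ⟧ x + c * x ^ k * ⟦ d ∷ ds ⟧ x ∎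
    where
    k : ℕ
    k = length ns ℕ.∸ length ds
    N : Carrier
    N = ⟦ ns ⟧ x
    len : length ns ≡ k ℕ.+ length ds
    len = ≡.sym (ℕ.m∸n+n≡m ds≤ns)

  lipschitz-monomial : ∀ c k {a} → LipschitzAt (λ x → c * x ^ k) a
  lipschitz-monomial c k = lipschitz-* (lipschitz-const c) (lipschitz-^ k lipschitz-id)

  -- The measure is the degree of the denominator plus the number of numerator coefficients. Every
  -- round lowers it by one, by dropping a zero head or a cancelled one, also when the roles are
  -- swapped. When the fuel is exhausted, the numerator is empty.
  cauchyIndex-correct : ∀ {n} {ρ : Vec Carrier n} k {u d us ds vs ns σ} → length ds ℕ.+ length ns ℕ.≤ k →
    Holds ρ u d → Holds* ρ us ds → Holds* ρ vs ns → ¬ (d ≈ 0#) → sgn d ≡ σ →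
    WP (λ _ → Index ⟦ d ∷ ds ⟧ ⟦ ns ⟧) ρ (cauchyIndex k σ u us vs) (cauchyIndexCost k)

  cauchyIndexStep-correct : ∀ {n} {ρ : Vec Carrier n} k {u d us ds v m vs ns σ τ} →
    length ds ℕ.+ length ns ℕ.≤ k →
    Holds ρ u d → Holds* ρ us ds → Holds ρ v m → Holds* ρ vs ns →
    ¬ (d ≈ 0#) → ¬ (m ≈ 0#) → sgn d ≡ σ → sgn m ≡ τ → (dec : Dec (length us ℕ.≤ length vs)) →
    WP (λ _ → Index ⟦ d ∷ ds ⟧ ⟦ m ∷ ns ⟧) ρ (cauchyIndexStep k σ τ u us v vs dec)
       (suc (2 ℕ.* k ℕ.+ cauchyIndexCost k))

  quotient-exists : ∀ {x y} → ¬ (y ≈ 0#) → ∃[ z ] z * y ≈ x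
  quotient-exists {x} {y} y≉0 with y⁻¹ , yy⁻¹≈1 ← invertible y≉0 = x * y⁻¹ ,
    trans (solve 3 (λ x y z → x :* z :* y := x :* (y :* z)) refl x y y⁻¹) (trans (*-congˡ yy⁻¹≈1) (*-identityʳ x))

  cauchyIndex-correct zero    len hd hds [] d≉0 σ≡ = return (index-zero λ _ → refl)
  cauchyIndex-correct (suc k) len hd hds [] d≉0 σ≡ = return (index-zero λ _ → refl)
  cauchyIndex-correct zero {ds = ds} len hd hds (_∷_ {ys = ns} hn hns) d≉0 σ≡ =
    contradiction (≡.subst (ℕ._≤ 0) (ℕ.+-suc (length ds) (length ns)) len) λ ()
  cauchyIndex-correct (suc k) {ds = ds} len hd hds (_∷_ {y = m} {ys = ns} hn hns) d≉0 σ≡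
    with len′ ← ℕ.≤-pred (≡.subst (ℕ._≤ suc k) (ℕ.+-suc (length ds) (length ns)) len)
    with <-cmp m 0#
  ... | tri< m<0 m≉0 _ = less hn zero m<0
    (cauchyIndexStep-correct k len′ hd hds hn hns d≉0 m≉0 σ≡ (sgn-negative m<0) _)
  ... | tri> _ m≉0 0<m = greater hn zero 0<m
    (cauchyIndexStep-correct k len′ hd hds hn hns d≉0 m≉0 σ≡ (sgn-positive 0<m) _)
  ... | tri≈ _ m≈0 _ = equal hn zero m≈0 (relax (ℕ.m≤n⇒m≤1+n (ℕ.m≤n+m _ (2 ℕ.* k)))
    (mono (index-cong λ x → trans (+-congʳ (trans (*-congʳ m≈0) (zeroˡ _))) (+-identityˡ _))
      (cauchyIndex-correct k len′ hd hds hns d≉0 σ≡)))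

  cauchyIndexStep-correct k {d = d} {ds = ds} {m = m} {ns = ns} len hd hds hm hns d≉0 m≉0 σ≡ τ≡ (yes us≤vs)
    with c , cd≈m ← quotient-exists {m} d≉0 =
    arith c hm hd (d≉0 , cd≈m) (relax (ℕ.+-monoˡ-≤ _ (ℕ.*-monoʳ-≤ 2 (ℕ.m+n≤o⇒m≤o (length ds) len)))
      (bind (subScaled-correct (extend ⊑-∷ hns) here (extend ⊑-∷ hds)) λ ρ⊑ hns′ →
        mono (index-reduce (lipschitz-monomial c (length ns ℕ.∸ length ds)) (reduction-≈ ns ds cd≈m ds≤ns))
          (cauchyIndex-correct k (≡.subst (λ l → length ds ℕ.+ l ℕ.≤ k) (≡.sym (length-subMul ns c ds)) len)
            (ρ⊑ (⊑-∷ hd)) (extend (ρ⊑ ∘ ⊑-∷) hds) hns′ d≉0 σ≡)))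
    where
    ds≤ns : length ds ℕ.≤ length ns
    ds≤ns = ≡.subst₂ ℕ._≤_ (Pointwise-length hds) (Pointwise-length hns) us≤vs
  cauchyIndexStep-correct k {d = d} {ds = ds} {m = m} {ns = ns} len hd hds hm hns d≉0 m≉0 ≡.refl ≡.refl (no us≰vs)
    rewrite Pointwise-length hds | Pointwise-length hns
    with c , cm≈d ← quotient-exists {d} m≉0 =
    arith c hd hm (m≉0 , cm≈d) (relax
      (ℕ.+-mono-≤ (ℕ.*-monoʳ-≤ 2 (ℕ.m+n≤o⇒n≤o (length ds) len)) (ℕ.≤-reflexive (ℕ.+-identityʳ _)))
      (bind (subScaled-correct (extend ⊑-∷ hds) here (extend ⊑-∷ hns)) λ ρ⊑ hds′ →
        bind {c′ = 0} (cauchyIndex-correct k (≡.subst (ℕ._≤ k) (≡.trans (ℕ.+-comm (length ds) (length ns))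
            (≡.cong (ℕ._+_ (length ns)) (≡.sym (length-subMul ds c ns)))) len)
          (ρ⊑ (⊑-∷ hm)) (extend (ρ⊑ ∘ ⊑-∷) hns) hds′ m≉0 ≡.refl) λ _ I →
        -- The recursive call treats D - c x^k N over N. Reduction restores the multiple of N, and
        -- reciprocity then exchanges D and N.
        return (index-swap ds ns d≉0 m≉0
          (index-reduce (lipschitz-monomial c (length ds ℕ.∸ length ns))
            (reduction-≈ ds ns cm≈d (ℕ.<⇒≤ (ℕ.≰⇒> us≰vs))) I))))

-- The algorithm and its cost bound

levels : ℕ → List Ref
levels zero    = []
levels (suc n) = levels n ∷ʳ level n

tarskiTest : List Ref → List Ref → Program Bool
tarskiTest ps []       = return true
tarskiTest ps (d ∷ ds) =
  derivative (d ∷ ds) >>= λ (fs′ , _) →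
  negProduct fs′ ps >>= λ ns₁ →
  negProduct ns₁ ps >>= λ ns₂ →
  -- The sign is 1 because the leading coefficient of the derivative is the degree times a positive
  -- number. The fuel is the initial value of the measure.
  cauchyIndex (length ds ℕ.+ length ns₁) ℤ.1ℤ d ds ns₁ >>= λ j₁ →
  cauchyIndex (length ds ℕ.+ length ns₂) ℤ.1ℤ d ds ns₂ >>= λ j₂ →
  return (does (j₁ ℤ.+ j₂ ℤ.≟ ℤ.0ℤ))

-- The parity of `d` is settled while the tree is built and costs no operation. In odd degree p is
-- negative near -∞.
decide : ∀ d → Dec (flip d ℤ.1ℤ ≡ ℤ.1ℤ) → List Ref → Program Bool
decide d (yes _) ps = derivative ps >>= λ (fs , _) → tarskiTest ps fs
decide d (no _)  ps = return false

algorithm : Algorithm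
algorithm d = compile (suc d) (decide d (flip d ℤ.1ℤ ℤ.≟ ℤ.1ℤ) (levels (suc d)))

-- Here `n` is d - 1, the degree of f, `2 + n` is the number of coefficients of p, and `l` is the
-- length of the list for - f′ p with its spare zero.
tarskiTestCost : ℕ → ℕ
tarskiTestCost n =
  2 ℕ.* n ℕ.+ (n ℕ.* (2 ℕ.* (2 ℕ.+ n)) ℕ.+ (l ℕ.* (2 ℕ.* (2 ℕ.+ n)) ℕ.+
  (cauchyIndexCost (n ℕ.+ l) ℕ.+ (cauchyIndexCost (n ℕ.+ (l ℕ.+ (2 ℕ.+ n))) ℕ.+ 0))))
  where
  l : ℕ
  l = n ℕ.+ (2 ℕ.+ n)

cauchyIndexCost≡ : ∀ k → cauchyIndexCost k ≡ k ℕ.* suc k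
cauchyIndexCost≡ zero    = ≡.refl
cauchyIndexCost≡ (suc k) rewrite cauchyIndexCost≡ k =
  solve 1 (λ k → con 2 :+ (con 2 :* k :+ k :* (con 1 :+ k)) := (con 1 :+ k) :* (con 2 :+ k)) ≡.refl k
  where open Data.Nat.Solver.+-*-Solver

cost-bound : ∀ n → 2 ℕ.* suc n ℕ.+ tarskiTestCost n ℕ.≤ 36 ℕ.* suc n ℕ.^ 2
cost-bound n rewrite cauchyIndexCost≡ (n ℕ.+ (n ℕ.+ (2 ℕ.+ n)))
                   | cauchyIndexCost≡ (n ℕ.+ (n ℕ.+ (2 ℕ.+ n) ℕ.+ (2 ℕ.+ n))) =
  -- The difference of the two sides is exactly 5 n² + n. At n = 0 both sides are 36, which is where
  -- the constant comes from.
  ℕ.m+n≤o⇒m≤o _ {5 ℕ.* n ℕ.* n ℕ.+ n} (ℕ.≤-reflexive (solve 1 (λ n →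
    let l = n :+ (con 2 :+ n) ; k₁ = n :+ l ; k₂ = n :+ (l :+ (con 2 :+ n)) in
    con 2 :* (con 1 :+ n) :+ (con 2 :* n :+ (n :* (con 2 :* (con 2 :+ n)) :+ (l :* (con 2 :* (con 2 :+ n)) :+
      (k₁ :* (con 1 :+ k₁) :+ (k₂ :* (con 1 :+ k₂) :+ con 0))))) :+ (con 5 :* n :* n :+ n)
    := con 36 :* (con 1 :+ n) :^ 2) ≡.refl n))
  where open Data.Nat.Solver.+-*-Solver

-- Correctness of the algorithm

module Correctness (R : CompleteOrderedField) where

  open CompleteOrderedField R hiding (zero)
  open OrderedFieldProperties R
  open Polynomials R
  open CauchyIndex R using (Index)
  open TarskiQuery R
  open Execution R
  open Semantics R
  open Algebra.Properties.Semiring.Sum semiring using (*-distribˡ-sum; sum-cong-≋)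
  open ≤-Reasoning

  NonNegative : List Carrier → Set
  NonNegative cs = ∀ x → 0# ≤ ⟦ cs ⟧ x

  fromℕ-positive : ∀ n → 0# < fromℕ (suc n)
  fromℕ-positive zero    = <-respʳ-≈ (sym (+-identityˡ 1#)) 0<1
  fromℕ-positive (suc n) = +-positive (fromℕ-positive n) (<⇒≤ 0<1)

  module _ {e : Carrier} (es : List Carrier) (0<e : 0# < e) (even : flip (length es) ℤ.1ℤ ≡ ℤ.1ℤ)
           {c : Carrier} (cs : List Carrier) (0<c : 0# < c) (deriv≡ : deriv (e ∷ es) ≡ c ∷ cs)
           (n : ℕ) (es-length : length es ≡ suc n) (cs-length : length cs ≡ n) where

    open Criterion es cs 0<e (>⇒≉ 0<c) deriv≡

    private
      fs′ ns₁ ns₂ : List Carrier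
      fs′ = deriv (c ∷ cs)
      ns₁ = negMul fs′ (e ∷ es)
      ns₂ = negMul ns₁ (e ∷ es)

      fs′-length : length fs′ ≡ n
      fs′-length = ≡.trans (length-deriv c cs) cs-length

      ns₁-length : length ns₁ ≡ n ℕ.+ (2 ℕ.+ n)
      ns₁-length = ≡.trans (length-negMul fs′ (e ∷ es)) (≡.cong₂ ℕ._+_ fs′-length (≡.cong suc es-length))

      ns₂-length : length ns₂ ≡ n ℕ.+ (2 ℕ.+ n) ℕ.+ (2 ℕ.+ n)
      ns₂-length = ≡.trans (length-negMul ns₁ (e ∷ es)) (≡.cong₂ ℕ._+_ ns₁-length (≡.cong suc es-length))

      N₁≈ : ∀ x → ⟦ ns₁ ⟧ x ≈ ⟦ fs′ ⟧ x * - ⟦ e ∷ es ⟧ x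
      N₁≈ x = trans (⟦⟧-negMul fs′ (e ∷ es) x)
        (solve 2 (λ a b → :- (a :* b) := a :* :- b) refl (⟦ fs′ ⟧ x) (⟦ e ∷ es ⟧ x))

      N₂≈ : ∀ x → ⟦ ns₂ ⟧ x ≈ ⟦ fs′ ⟧ x * (⟦ e ∷ es ⟧ x * ⟦ e ∷ es ⟧ x)
      N₂≈ x = trans (⟦⟧-negMul ns₁ (e ∷ es) x) (trans (-‿cong (*-congʳ (N₁≈ x)))
        (solve 2 (λ a b → :- ((a :* :- b) :* b) := a :* (b :* b)) refl (⟦ fs′ ⟧ x) (⟦ e ∷ es ⟧ x)))

      index-run : ∀ {m} {ρ : Vec Carrier m} {d ds vs ns l} → Holds ρ d c → Holds* ρ ds cs → Holds* ρ vs ns →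
        length ns ≡ l → WP (λ _ → Index ⟦ c ∷ cs ⟧ ⟦ ns ⟧) ρ
          (cauchyIndex (length ds ℕ.+ length vs) ℤ.1ℤ d ds vs) (cauchyIndexCost (n ℕ.+ l))
      index-run hd hds hns ≡.refl
        rewrite Pointwise-length hds | Pointwise-length hns
        = relax (ℕ.≤-reflexive (≡.cong (λ m → cauchyIndexCost (m ℕ.+ _)) cs-length))
            (cauchyIndex-correct _ ℕ.≤-refl hd hds hns (>⇒≉ 0<c) (sgn-positive 0<c))

    tarskiTest-correct : ∀ {m} {ρ : Vec Carrier m} {ps ds} → Holds* ρ ps (e ∷ es) → Holds* ρ ds (c ∷ cs) →
      WP (λ _ → Reflects (NonNegative (e ∷ es))) ρ (tarskiTest ps ds) (tarskiTestCost n)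
    tarskiTest-correct hps (hd ∷ hds) =
      bind (relax (ℕ.≤-reflexive (≡.cong (ℕ._*_ 2) cs-length)) (derivative-correct (hd ∷ hds))) λ ⊑₁ (hfs′ , _) →
      bind (relax (ℕ.≤-reflexive (≡.cong₂ (λ a b → a ℕ.* (2 ℕ.* b)) fs′-length (≡.cong suc es-length)))
        (negProduct-correct hfs′ (extend ⊑₁ hps))) λ ⊑₂ hns₁ →
      bind (relax (ℕ.≤-reflexive (≡.cong₂ (λ a b → a ℕ.* (2 ℕ.* b)) ns₁-length (≡.cong suc es-length)))
        (negProduct-correct hns₁ (extend (⊑₂ ∘ ⊑₁) hps))) λ ⊑₃ hns₂ →
      bind (index-run (⊑₃ (⊑₂ (⊑₁ hd))) (extend (⊑₃ ∘ ⊑₂ ∘ ⊑₁) hds) (extend ⊑₃ hns₁) ns₁-length) λ ⊑₄ I₁ →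
      bind (index-run (⊑₄ (⊑₃ (⊑₂ (⊑₁ hd)))) (extend (⊑₄ ∘ ⊑₃ ∘ ⊑₂ ∘ ⊑₁) hds) (extend ⊑₄ hns₂) ns₂-length) λ _ I₂ →
      return (answer-correct I₁ I₂)
      where
      answer-correct : ∀ {j₁ j₂} → Index ⟦ c ∷ cs ⟧ ⟦ ns₁ ⟧ j₁ →
        Index ⟦ c ∷ cs ⟧ ⟦ ns₂ ⟧ j₂ →
        Reflects (NonNegative (e ∷ es)) (does (j₁ ℤ.+ j₂ ℤ.≟ ℤ.0ℤ))
      answer-correct {j₁} {j₂} I₁ I₂ with j₁ ℤ.+ j₂ ℤ.≟ ℤ.0ℤ
      ... | yes j≡0 = ofʸ (¬badRoot⇒nonNegative even (index≡0⇒¬badRoot ns₁ ns₂ N₁≈ N₂≈ I₁ I₂ j≡0))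
      ... | no  j≢0 = ofⁿ λ 0≤p → j≢0 (nonNegative⇒index≡0 ns₁ ns₂ N₁≈ N₂≈ I₁ I₂ 0≤p)

  decide-correct : ∀ {m} {ρ : Vec Carrier m} {d e es ps} → 1 ℕ.≤ d → 0# < e → length es ≡ d →
    Holds* ρ ps (e ∷ es) → (even? : Dec (flip d ℤ.1ℤ ≡ ℤ.1ℤ)) →
    WP (λ _ → Reflects (NonNegative (e ∷ es))) ρ (decide d even? ps) (36 ℕ.* d ℕ.^ 2)
  decide-correct {e = e} {es = b ∷ bs} (s≤s _) 0<e ≡.refl (hp ∷ hps) (yes even) =
    relax (cost-bound (length bs)) (bind (derivative-correct (hp ∷ hps)) λ ρ⊑ (hfs , _) →
      tarskiTest-correct (b ∷ bs) 0<e even (deriv (b ∷ bs)) (*-positive (fromℕ-positive (length bs)) 0<e) ≡.refl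
        (length bs) ≡.refl (length-deriv b bs) (extend ρ⊑ (hp ∷ hps)) hfs)
  decide-correct {es = es} 1≤d 0<e ≡.refl hps (no odd) with flip-±1 (length es)
  ... | inj₁ even = contradiction even odd
  ... | inj₂ ≡-1  = return (ofⁿ (odd⇒¬nonNegative es 0<e ≡-1))

  descending : ∀ {n} → Vec Carrier n → List Carrier
  descending []       = []
  descending (a ∷ as) = descending as ∷ʳ a

  -- Register 0 holds the constant coefficient and counts as the newest, so the leading coefficient
  -- has level 0 and ascending levels list the coefficients from the leading end.
  levels-hold : ∀ {n} (ρ : Vec Carrier n) → Holds* ρ (levels n) (descending ρ)
  levels-hold []      = []
  levels-hold (a ∷ ρ) = Pointwise.++⁺ (extend ⊑-∷ (levels-hold ρ)) (here ∷ [])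

  descending-last : ∀ {n} (p : Vec Carrier (suc n)) → ∃[ es ] descending p ≡ last p ∷ es × length es ≡ n
  descending-last (a ∷ []) = [] , ≡.refl , ≡.refl
  descending-last (a ∷ b ∷ p) with es , eq , len ← descending-last (b ∷ p) =
    es ∷ʳ a , ≡.cong (_∷ʳ a) eq , ≡.trans (List.length-++ es) (≡.trans (ℕ.+-comm _ 1) (≡.cong suc len))

  ⟦⟧-∷ʳ : ∀ cs a x → ⟦ cs ∷ʳ a ⟧ x ≈ a + x * ⟦ cs ⟧ x
  ⟦⟧-∷ʳ [] a x = solve 2 (λ a x → a :* con (+ 1) :+ con (+ 0) := a :+ x :* con (+ 0)) refl a x
  ⟦⟧-∷ʳ (c ∷ cs) a x = begin-equality
    c * x ^ length (cs ∷ʳ a) + ⟦ cs ∷ʳ a ⟧ x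
      ≈⟨ +-cong (*-congˡ (reflexive (≡.cong (x ^_) (≡.trans (List.length-++ cs) (ℕ.+-comm _ 1))))) (⟦⟧-∷ʳ cs a x) ⟩
    c * (x * x ^ length cs) + (a + x * ⟦ cs ⟧ x)
      ≈⟨ solve 5 (λ c x X a F → c :* (x :* X) :+ (a :+ x :* F) := a :+ x :* (c :* X :+ F))
           refl c x (x ^ length cs) a (⟦ cs ⟧ x) ⟩
    a + x * (c * x ^ length cs + ⟦ cs ⟧ x) ∎

  eval-∷ : ∀ {n} a (p : Vec Carrier n) x → eval (a ∷ p) x ≈ a + x * eval p x
  eval-∷ a p x = +-cong (*-identityʳ a) (begin-equality
    sum (λ i → lookup p i * (x * x ^ toℕ i))
      ≈⟨ sum-cong-≋ (λ i → solve 3 (λ a x X → a :* (x :* X) := x :* (a :* X)) refl (lookup p i) x (x ^ toℕ i)) ⟩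
    sum (λ i → x * (lookup p i * x ^ toℕ i))
      ≈⟨ *-distribˡ-sum x (λ i → lookup p i * x ^ toℕ i) ⟨
    x * eval p x ∎)

  ⟦⟧-descending : ∀ {n} (p : Vec Carrier n) x → ⟦ descending p ⟧ x ≈ eval p x
  ⟦⟧-descending []      x = refl
  ⟦⟧-descending (a ∷ p) x = trans (⟦⟧-∷ʳ (descending p) a x)
    (trans (+-congˡ (*-congˡ (⟦⟧-descending p x))) (sym (eval-∷ a p x)))

  algorithm-correct : ∀ d → 1 ℕ.≤ d → (p : Vec Carrier (suc d)) → Monic p →
    ∃[ b ] ∃[ k ] (p ⊢ algorithm d ⇓ b after k) × Reflects (Nonnegative p) b × k ℕ.≤ 36 ℕ.* d ℕ.^ 2
  algorithm-correct d 1≤d p monic with es , eq , len ← descending-last p =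
    compile-correct (mono transfer (decide-correct 1≤d 0<last len
      (≡.subst (Holds* p (levels (suc d))) eq (levels-hold p)) (flip d ℤ.1ℤ ℤ.≟ ℤ.1ℤ)))
    where
    0<last : 0# < last p
    0<last = <-respʳ-≈ (sym monic) 0<1
    p≈ : ∀ x → ⟦ last p ∷ es ⟧ x ≈ eval p x
    p≈ x = ≡.subst (λ cs → ⟦ cs ⟧ x ≈ eval p x) eq (⟦⟧-descending p x)
    transfer : ∀ {b} → Reflects (NonNegative (last p ∷ es)) b → Reflects (Nonnegative p) b
    transfer (ofʸ 0≤p)  = ofʸ λ x → ≤-trans (0≤p x) (≤-reflexive (p≈ x))
    transfer (ofⁿ ¬0≤p) = ofⁿ λ 0≤p → ¬0≤p λ x → ≤-trans (0≤p x) (≤-reflexive (sym (p≈ x)))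

open import Data.Nat.Base using (_≤_; _*_; _^_)

mainTheorem3 : Σ[ alg ∈ Algorithm ] Σ[ C ∈ ℕ ] ((R : CompleteOrderedField) →
    let open CompleteOrderedField R using (Carrier)
        open Semantics R
    in (d : ℕ) → 1 ≤ d → (p : Vec Carrier (suc d)) → Monic p →
       ∃[ b ] ∃[ k ] (p ⊢ alg d ⇓ b after k) ×
                     Reflects (Nonnegative p) b ×
                     k ≤ C * d ^ 2)
mainTheorem3 = algorithm , 36 , λ R → Correctness.algorithm-correct R
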